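{- Let $\mathcal{X},\mathcal{Y},\mathcal{Z}$ be non-empty finite sets. For any relation $f:\mathcal{X}\times\mathcal{Y}\rightarrow 2^{\mathcal{Z}}$ and any error function $\mathscr{E}:\mathcal{X}\times\mathcal{Y}\rightarrow[0,1]$, $$IC(f,\mathscr{E})\ \le\ IC_\infty(f,\mathscr{E})\ \le\ R(f,\mathscr{E}),$$ where $IC$ is external information complexity, $IC_\infty$ is Rényi information complexity, and $R$ is public-coin worst-case communication complexity, as defined in the context.
   Context: All logarithms are to base 2. An infimum over an empty set is $+\infty$. Inequalities between functions on $\mathcal{X}\times\mathcal{Y}$ are pointwise. **Protocols.** Alice has input $x\in\mathcal{X}$, Bob has input $y\in\mathcal{Y}$, and they want to output some $z\in f(x,y)$. A (public-coin, two-party) protocol $\pi$ uses a common random string $\Phi$ (the public coins), independent of the inputs, and private local randomness of Alice and of Bob; all three are discrete random variables, mutually independent and independent of the inputs. For each value $\phi$ of the public coins, the communication follows a binary tree of finite depth each of whose internal nodes is owned by Alice or Bob: at a node, its owner sends a bit determined by the node, $\phi$, and the owner's input and private randomness, and the execution moves to the corresponding child; communication stops at a leaf. The transcript $\Psi$ is the string of bits exchanged. Each party then outputs an element of $\mathcal{Z}$ determined by the transcript, $\phi$, and its own input and private randomness; for the protocol to be valid, the two outputs must agree with probability 1 on every input pair, and the common output is denoted $\pi(x,y)$. The error function is $$\mathrm{err}_{f,\pi}(x,y)=\Pr[\pi(x,y)\notin f(x,y)],$$ the probability being over the randomness in the protocol execution. Let $\Pi=(\Phi,\Psi)$ denote the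 public coins together with the transcript; given a distribution $\mathbf{p}_{X,Y}$ of the inputs, $\Pi$ is jointly distributed with $(X,Y)$. Let $\#\mathrm{bits}(\pi,x,y)$ be the maximum, over all choices of (public and private) randomness, of the number of bits exchanged (the length of $\Psi$) in an execution of $\pi$ on inputs $(x,y)$ (it does not count the public coins). **Complexity measures.** Below, infima are over (valid) protocols $\pi$ with $\mathrm{err}_{f,\pi}\le\mathscr{E}$, and $\max_{\mathbf{p}_{X,Y}}$ is over all probability distributions on $\mathcal{X}\times\mathcal{Y}$: $$R(f,\mathscr{E})=\inf_{\pi}\max_{x,y}\#\mathrm{bits}(\pi,x,y),\qquad IC(f,\mathscr{E})=\inf_{\pi}\max_{\mathbf{p}_{X,Y}}I(X,Y;\Pi),\qquad IC_\infty(f,\mathscr{E})=\inf_{\pi}\max_{\mathbf{p}_{X,Y}}I_\infty(X,Y;\Pi).$$ Here $I$ is Shannon's mutual information and, for random variables $(A,B)$ over $\mathcal{A}\times\mathcal{B}$, the Rényi mutual information of order $\infty$ is $$I_\infty(A;B)=\log\Big(\sum_{b\in\mathcal{B}}\ \max_{a\in\mathcal{A}:\,\mathbf{p}_A(a)>0}\mathbf{p}_{B|A}(b|a)\Big).$$ -}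

module Defs where

open import Algebra.Bundles using (CommutativeRing; Semiring)
import Algebra.Definitions.RawSemiring as RawSemiringDefinitions
open import Axiom.ExcludedMiddle using (ExcludedMiddle)
open import Data.Bool.Base using (Bool; true; false; T; if_then_else_)
open import Data.List.Base using (List; []; _∷_; length; map; foldr)
open import Data.List.Relation.Binary.Subset.Propositional using (_⊆_)
open import Data.List.Relation.Unary.Unique.Propositional using (Unique)
open import Data.Nat.Base using (ℕ; suc)
open import Data.Product.Base using (Σ; ∃; ∃₂; _×_; _,_; proj₁; proj₂)
open import Level using (0ℓ; Level)
open import Relation.Binary.Core using (Rel)
open import Relation.Binary.PropositionalEquality using (_≡_; refl; subst)
open import Relation.Binary.Structures using (IsTotalOrder)
import Relation.Binary.Construct.Add.Extrema.NonStrict as Extended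
import Relation.Binary.Construct.Add.Supremum.NonStrict as AddSupremum
import Relation.Binary.Construct.NonStrictToStrict as ToStrict
open import Relation.Nullary using (¬_; yes; no; contradiction)
open import Relation.Nullary.Construct.Add.Extrema using (_±; ⊥±; ⊤±; [_])
open import Relation.Nullary.Decidable using (⌊_⌋; toWitness; fromWitness)
open import Relation.Unary using (Pred; _∉_)

-- The real numbers, axiomatised (up to unique isomorphism) as a
-- Dedekind-complete ordered field.

record CompleteOrderedField : Set₁ where
  infix 4 _≤_ _<_
  field
    commutativeRing : CommutativeRing 0ℓ 0ℓ
  open CommutativeRing commutativeRing public
  field
    _≤_          : Rel Carrier 0ℓ
    isTotalOrder : IsTotalOrder _≈_ _≤_
    +-monoˡ-≤    : ∀ {x y} z → x ≤ y → (x + z) ≤ (y + z)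
    *-nonNeg     : ∀ {x y} → 0# ≤ x → 0# ≤ y → 0# ≤ (x * y)
    0≉1          : ¬ (0# ≈ 1#)
    inverse      : ∀ {x} → ¬ (x ≈ 0#) → ∃ λ y → (x * y) ≈ 1#
    complete     : (P : Pred Carrier 0ℓ) → ∃ P →
                   (∃ λ u → ∀ x → P x → x ≤ u) →
                   ∃ λ s → (∀ x → P x → x ≤ s) ×
                           (∀ u → (∀ x → P x → x ≤ u) → s ≤ u)

  _<_ : Rel Carrier 0ℓ
  _<_ = ToStrict._<_ _≈_ _≤_

module Analysis (em : ∀ {ℓ : Level} → ExcludedMiddle ℓ)
                (real-field : CompleteOrderedField) where

  open CompleteOrderedField real-field public
  open IsTotalOrder isTotalOrder public
    using (antisym; total) renaming (refl to ≤-refl; trans to ≤-trans)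
  open RawSemiringDefinitions (Semiring.rawSemiring semiring) public
    using (_^_) renaming (_×_ to infixr 8 _·_)
  open Extended _≤_ public using (_≤±_; ⊥±≤_; _≤⊤±; [≤]-injective)

  infixl 7 _÷_
  infix  8 _⁻¹

  ℝ : Set
  ℝ = Carrier

  ℝ± : Set
  ℝ± = ℝ ±

  fromℕ : ℕ → ℝ
  fromℕ n = n · 1#

  _⁻¹ : ℝ → ℝ
  x ⁻¹ with em {P = x ≈ 0#}
  ... | yes _  = 0#
  ... | no x≉0 = proj₁ (inverse x≉0)

  _÷_ : ℝ → ℝ → ℝ
  x ÷ y = x * y ⁻¹

  𝟙 : Set → ℝ
  𝟙 E = if ⌊ em {P = E} ⌋ then 1# else 0#

  IsLub : ∀ {ℓ} {I : Set ℓ} → (I → ℝ±) → ℝ± → Set ℓ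
  IsLub F s = (∀ i → F i ≤± s) × (∀ t → (∀ i → F i ≤± t) → s ≤± t)

  [_]≰⊥± : ∀ r → ¬ ([ r ] ≤± ⊥±)
  [ r ]≰⊥± AddSupremum.[ () ]

  lub : ∀ {ℓ} {I : Set ℓ} (F : I → ℝ±) → ∃ (IsLub F)
  lub {I = I} F with em {P = ∃ λ i → F i ≡ ⊤±}
  ... | yes (i , Fi≡⊤) =
    ⊤± , (λ j → F j ≤⊤±)
       , λ t ub → subst (_≤± t) Fi≡⊤ (ub i)
  ... | no ¬top with em {P = ∃₂ λ i r → F i ≡ [ r ]}
  ...   | no ¬fin = ⊥± , below , λ t _ → ⊥±≤ t
    where
    below : ∀ i → F i ≤± ⊥±
    below i with F i in eq
    ... | ⊥±    = ⊥±≤ ⊥±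
    ... | [ r ] = contradiction (i , r , eq) ¬fin
    ... | ⊤±    = contradiction (i , eq) ¬top
  ...   | yes (i₀ , r₀ , eq₀) with em {P = ∃ λ u → ∀ i → F i ≤± [ u ]}
  ...     | no unbounded = ⊤± , (λ j → F j ≤⊤±) , least
    where
    least : ∀ t → (∀ i → F i ≤± t) → ⊤± ≤± t
    least ⊤±    _  = ⊤± ≤⊤±
    least [ u ] ub = contradiction (u , ub) unbounded
    least ⊥±    ub = contradiction (subst (_≤± ⊥±) eq₀ (ub i₀)) [ r₀ ]≰⊥±
  ...     | yes (u₀ , ub₀) = [ s ] , above , least
    where
    -- Excluded middle resizes this predicate to the bottom universe.
    P : Pred ℝ 0ℓ
    P x = T ⌊ em {P = ∃ λ i → F i ≡ [ x ]} ⌋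

    bounded : ∀ u → (∀ i → F i ≤± [ u ]) → ∀ x → P x → x ≤ u
    bounded u ub x px with toWitness px
    ... | i , eq = [≤]-injective (subst (_≤± [ u ]) eq (ub i))

    sup : ∃ λ s → (∀ x → P x → x ≤ s) × (∀ u → (∀ x → P x → x ≤ u) → s ≤ u)
    sup = complete P (r₀ , fromWitness (i₀ , eq₀)) (u₀ , bounded u₀ ub₀)

    s : ℝ
    s = proj₁ sup

    above : ∀ i → F i ≤± [ s ]
    above i with F i in eq
    ... | ⊥±    = ⊥±≤ [ s ]
    ... | [ r ] = Extended.[ proj₁ (proj₂ sup) r (fromWitness (i , eq)) ]
    ... | ⊤±    = contradiction (i , eq) ¬top

    least : ∀ t → (∀ i → F i ≤± t) → [ s ] ≤± t
    least ⊤±    _  = [ s ] ≤⊤±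
    least [ u ] ub = Extended.[ proj₂ (proj₂ sup) u (bounded u ub) ]
    least ⊥±    ub = contradiction (subst (_≤± ⊥±) eq₀ (ub i₀)) [ r₀ ]≰⊥±

  ⨆ : ∀ {ℓ} {I : Set ℓ} → (I → ℝ±) → ℝ±
  ⨆ F = proj₁ (lub F)

  ⨅ : ∀ {ℓ} {I : Set ℓ} → (I → ℝ±) → ℝ±
  ⨅ F = ⨆ {I = Σ ℝ± λ t → ∀ i → t ≤± F i} proj₁

  -- The value at ±∞ is junk: `real` is only applied to suprema of
  -- non-empty bounded families.
  real : ℝ± → ℝ
  real [ r ] = r
  real ⊥±    = 0#
  real ⊤±    = 0#

  -- log₂ x is the supremum of the rationals (k − m)/(n + 1) with
  -- 2^(k − m) ≤ x^(n + 1); meaningful for x > 0 only.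
  log₂ : ℝ → ℝ
  log₂ x = real (⨆ {I = Exponent} value)
    where
    2# : ℝ
    2# = fromℕ 2

    Exponent : Set
    Exponent = Σ (ℕ × ℕ × ℕ) λ (k , m , n) → 2# ^ k ≤ 2# ^ m * x ^ suc n

    value : Exponent → ℝ±
    value ((k , m , n) , _) = [ (fromℕ k - fromℕ m) ÷ fromℕ (suc n) ]

  finiteSum : ∀ {A : Set} → (A → ℝ) → List A → ℝ
  finiteSum f xs = foldr _+_ 0# (map f xs)

  -- Unconditional convergence: finite partial sums converge to s along the
  -- finite subsets of A, represented by repetition-free lists.
  HasSum : ∀ {A : Set} → (A → ℝ) → ℝ → Set
  HasSum {A} f s = ∀ ε → 0# < ε →
    ∃ λ (F : List A) → ∀ (G : List A) → Unique G → F ⊆ G →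
      (s - ε ≤ finiteSum f G) × (finiteSum f G ≤ s + ε)

  -- A divergent sum is given the junk value 0.
  ∑ : ∀ {A : Set} → (A → ℝ) → ℝ
  ∑ f with em {P = ∃ (HasSum f)}
  ... | yes (s , _) = s
  ... | no _        = 0#

  -- A discrete probability distribution. No countability of A is required:
  -- summability already makes the support countable.
  record Dist (A : Set) : Set where
    field
      pmf     : A → ℝ
      nonNeg  : ∀ a → 0# ≤ pmf a
      sumsTo1 : HasSum pmf 1#

  open Dist public

  -- In the following, J is the joint probability mass function of a pair of
  -- random variables over A × B, with A finite. All the sums then converge,
  -- also when B is infinite.
  module _ {A B : Set} (J : A × B → ℝ) where

    marginalˡ : A → ℝ
    marginalˡ a = ∑ λ b → J (a , b)

    marginalʳ : B → ℝ
    marginalʳ b = ∑ λ a → J (a , b)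

    conditional : B → A → ℝ
    conditional b a = J (a , b) ÷ marginalˡ a

    -- When J (a , b) = 0 the summand is 0, whatever the junk values of log₂
    -- and division.
    mutualInformation : ℝ
    mutualInformation =
      ∑ {A = A × B} λ (a , b) → J (a , b) * log₂ (J (a , b) ÷ (marginalˡ a * marginalʳ b))

    rényiMutualInformation : ℝ
    rényiMutualInformation =
      log₂ (∑ λ b → real (⨆ {I = Σ A λ a → 0# < marginalˡ a}
                            λ (a , _) → [ conditional b a ]))

module Communication (em : ∀ {ℓ : Level} → ExcludedMiddle ℓ)
                     (real-field : CompleteOrderedField) where

  open Analysis em real-field public

  -- U and V are what Alice and Bob see: input and private randomness. The
  -- first subtree is taken when the bit sent is false.
  data Tree (U V : Set) : Set where
    leaf  : Tree U V
    alice : (U → Bool) → Tree U V → Tree U V → Tree U V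
    bob   : (V → Bool) → Tree U V → Tree U V → Tree U V

  transcript : ∀ {U V : Set} → Tree U V → U → V → List Bool
  transcript leaf            u v = []
  transcript (alice bit l r) u v with bit u
  ... | false = false ∷ transcript l u v
  ... | true  = true  ∷ transcript r u v
  transcript (bob bit l r)   u v with bit v
  ... | false = false ∷ transcript l u v
  ... | true  = true  ∷ transcript r u v

  record Protocol (X Y Z : Set) : Set₁ where
    field
      Coins CoinsA CoinsB : Set
      public-coins  : Dist Coins
      private-coinsA : Dist CoinsA
      private-coinsB : Dist CoinsB
      tree    : Coins → Tree (X × CoinsA) (Y × CoinsB)
      outputA : List Bool → Coins → X → CoinsA → Z
      outputB : List Bool → Coins → Y → CoinsB → Z

  module _ {X Y Z : Set} (π : Protocol X Y Z) where
    open Protocol π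

    Outcome : Set
    Outcome = Coins × CoinsA × CoinsB

    probability : Outcome → ℝ
    probability (φ , a , b) =
      pmf public-coins φ * (pmf private-coinsA a * pmf private-coinsB b)

    Pr : (Outcome → Set) → ℝ
    Pr E = ∑ λ ω → probability ω * 𝟙 (E ω)

    Ψ : X → Y → Outcome → List Bool
    Ψ x y (φ , a , b) = transcript (tree φ) (x , a) (y , b)

    Π : X → Y → Outcome → Coins × List Bool
    Π x y ω@(φ , _) = φ , Ψ x y ω

    resultA resultB : X → Y → Outcome → Z
    resultA x y ω@(φ , a , _) = outputA (Ψ x y ω) φ x a
    resultB x y ω@(φ , _ , b) = outputB (Ψ x y ω) φ y b

    Valid : Set
    Valid = ∀ x y → Pr (λ ω → resultA x y ω ≡ resultB x y ω) ≈ 1#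

    -- For a valid protocol the two results agree almost surely, so either
    -- one can serve as the common output.
    err : (X → Y → Pred Z 0ℓ) → X → Y → ℝ
    err f x y = Pr λ ω → resultA x y ω ∉ f x y

    joint : Dist (X × Y) → (X × Y) × (Coins × List Bool) → ℝ
    joint p ((x , y) , τ) = pmf p (x , y) * Pr (λ ω → Π x y ω ≡ τ)

    -- Only outcomes of positive probability are possible choices of the
    -- randomness. The value is ⊤± when their lengths are unbounded.
    #bits : X → Y → ℝ±
    #bits x y = ⨆ {I = Σ Outcome λ ω → 0# < probability ω}
                  λ (ω , _) → [ fromℕ (length (Ψ x y ω)) ]

  -- The maxima over input distributions and over input pairs are written as
  -- suprema in ℝ±.
  module _ {X Y Z : Set} (f : X → Y → Pred Z 0ℓ) (ℰ : X → Y → ℝ) where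

    Admissible : Set₁
    Admissible = Σ (Protocol X Y Z) λ π → Valid π × (∀ x y → err π f x y ≤ ℰ x y)

    R : ℝ±
    R = ⨅ {I = Admissible} λ (π , _) →
          ⨆ {I = X × Y} λ (x , y) → #bits π x y

    IC : ℝ±
    IC = ⨅ {I = Admissible} λ (π , _) →
           ⨆ {I = Dist (X × Y)} λ p → [ mutualInformation (joint π p) ]

    IC∞ : ℝ±
    IC∞ = ⨅ {I = Admissible} λ (π , _) →
            ⨆ {I = Dist (X × Y)} λ p → [ rényiMutualInformation (joint π p) ]

-- Fix a protocol π, write q(τ|x,y) for the probability that Π = τ on the
-- inputs (x,y), M(τ) for its maximum over the inputs in the support of p, and
-- S = Σ_τ M(τ), so that I_∞ = log S.
--
-- I ≤ I_∞: each term p q log (q / m(τ)) of I, m being the distribution of Π, is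
-- at most p q log (M(τ) / m(τ)); bounding the concave function log by its
-- tangent at S and using Σ_τ m(τ) · M(τ) / m(τ) ≤ S gives at most log S.
--
-- I_∞ ≤ R: if at most d bits are exchanged, then M(φ,ψ) ≤ Pr[Φ = φ] when ψ is a
-- leaf of depth at most d of the tree for φ and M(φ,ψ) = 0 otherwise. A binary
-- tree has at most 2^d such leaves, hence S ≤ 2^d.

module Submission where

open import Defs
open import Algebra.Solver.Ring.AlmostCommutativeRing using (fromCommutativeRing; _-Raw-AlmostCommutative⟶_)
import Algebra.Solver.Ring
import Algebra.Properties.AbelianGroup as AbelianGroupProperties
import Algebra.Properties.CommutativeSemiring.Exp as Exp
import Algebra.Properties.Ring as RingProperties
import Algebra.Properties.Semiring.Mult as SemiringMult
import Algebra.Properties.Semiring.Mult.TCOptimised as Mult′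
open import Axiom.ExcludedMiddle using (ExcludedMiddle)
open import Data.Bool.Base using (Bool; true; false)
open import Data.Fin.Base using (Fin) renaming (zero to fzero)
open import Data.Integer.Base as ℤ using (ℤ; +_; -[1+_]; _⊖_)
import Data.Integer.Properties as ℤ
open import Data.List.Base using (List; []; _∷_; _++_; map; length; deduplicate; allFin; cartesianProduct)
open import Data.List.Membership.Propositional using (_∈_; _∉_)
open import Data.List.Membership.Propositional.Properties
  using (∈-∃++; ∈-++⁻; ∈-++⁺ˡ; ∈-++⁺ʳ; ∈-map⁺; ∈-deduplicate⁺; ∈-allFin; ∈-cartesianProduct⁺)
open import Data.List.Properties using (length-++; length-map)
open import Data.List.Relation.Binary.Subset.Propositional using (_⊆_)
open import Data.List.Relation.Unary.All using ([]; _∷_)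
open import Data.List.Relation.Unary.All.Properties using (All¬⇒¬Any)
open import Data.List.Relation.Unary.AllPairs using ([]; _∷_)
open import Data.List.Relation.Unary.Any using (here; there)
open import Data.List.Relation.Unary.Unique.Propositional using (Unique)
import Data.List.Relation.Unary.Unique.DecPropositional.Properties as UniqueDec
open import Data.Maybe.Base using (Maybe; just; nothing)
open import Data.Nat.Base as ℕ using (ℕ; zero; suc)
import Data.Nat.Properties as ℕ
open import Data.Product.Base using (Σ; ∃; ∃₂; _×_; _,_; proj₁; proj₂)
open import Data.Product.Properties using (,-injectiveˡ; ,-injectiveʳ)
open import Data.Sum.Base using (_⊎_; inj₁; inj₂; [_,_]′)
open import Function.Base using (_∘_; id)
open import Function.Bundles using (_↔_; Inverse)
open import Level using (Level; 0ℓ)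
open import Relation.Binary.Bundles using (Poset)
import Relation.Binary.Construct.Add.Extrema.NonStrict as Extended
open import Relation.Binary.Definitions using (DecidableEquality)
open import Relation.Binary.PropositionalEquality as ≡ using (_≡_; _≢_)
import Relation.Binary.Reasoning.PartialOrder as PartialOrderReasoning
import Relation.Binary.Structures as Structures
open import Relation.Nullary using (¬_; yes; no; contradiction)
open import Relation.Nullary.Construct.Add.Extrema using (⊥±; ⊤±; [_])
open import Relation.Unary using (Pred)

-- The logarithm is known only as the supremum of rationals (k - m)/(n + 1), so there is no
-- derivative from which to read off a tangent. Its laws come from comparing integer powers with an
-- error that stays bounded while n grows, and its concavity at 1 comes from Bernoulli's inequality.
-- The slope c of the tangent need not be evaluated: with w = M/m it multiplies (Σ p q w)/S - Σ p q,
-- which is at most 1 - 1 = 0, so c ≥ 0 suffices. The other obstacle is infinite sums. The coins may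
-- take infinitely many values, and the terms of I change sign, so that they escape the description
-- of a sum as a supremum of partial sums. The tangent bound, however, is linear in p q and p q w.
-- It is summed over finite lists, and only the totals of these two non-negative families enter. If
-- the sum defining I diverged, its default value 0 would still be at most log S, because S ≥ 1.

private
  variable
    A B : Set

module Proof (em : ∀ {ℓ : Level} → ExcludedMiddle ℓ) (real-field : CompleteOrderedField) where

  open Communication em real-field

  -- Equality of reals does not compute, so the ring solver takes its
  -- coefficients in ℤ.
  module IntegerCoefficients where
    open Mult′ semiring using () renaming (_×_ to _×′_; ×-homo-+ to ×′-homo-+; ×1-homo-* to ×′1-homo-*)
    open RingProperties ring using (-‿distribˡ-*; -0#≈0#; -‿involutive)
    open AbelianGroupProperties +-abelianGroup using (⁻¹-∙-comm)
    open import Relation.Binary.Reasoning.Setoid setoid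

    -- With the optimised multiple, 1 ×′ 1# is `1#` by definition. The coefficients 0 and 1
    -- therefore denote exactly `0#` and `1#`, as they occur in the goals.
    ⟦_⟧ : ℤ → ℝ
    ⟦ + n ⟧      = n ×′ 1#
    ⟦ -[1+ n ] ⟧ = - (suc n ×′ 1#)

    suc× : ∀ n → suc n ×′ 1# ≈ 1# + n ×′ 1#
    suc× n = ×′-homo-+ 1# 1 n

    ⊖-homo : ∀ m n → ⟦ m ⊖ n ⟧ ≈ m ×′ 1# - n ×′ 1#
    ⊖-homo zero    zero    = sym (-‿inverseʳ 0#)
    ⊖-homo zero    (suc n) = sym (+-identityˡ _)
    ⊖-homo (suc m) zero    = sym (trans (+-congˡ -0#≈0#) (+-identityʳ _))
    ⊖-homo (suc m) (suc n) rewrite ℤ.[1+m]⊖[1+n]≡m⊖n m n = begin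
      ⟦ m ⊖ n ⟧                          ≈⟨ ⊖-homo m n ⟩
      a - b                              ≈⟨ +-congʳ (+-identityˡ a) ⟨
      0# + a - b                         ≈⟨ +-congʳ (+-congʳ (-‿inverseʳ 1#)) ⟨
      1# - 1# + a - b                    ≈⟨ +-congʳ (+-assoc 1# (- 1#) a) ⟩
      1# + (- 1# + a) - b                ≈⟨ +-congʳ (+-congˡ (+-comm (- 1#) a)) ⟩
      1# + (a - 1#) - b                  ≈⟨ +-congʳ (+-assoc 1# a (- 1#)) ⟨
      1# + a - 1# - b                    ≈⟨ +-assoc (1# + a) (- 1#) (- b) ⟩
      1# + a + (- 1# - b)                ≈⟨ +-cong (sym (suc× m)) (⁻¹-∙-comm 1# b) ⟩
      suc m ×′ 1# - (1# + b)             ≈⟨ +-congˡ (-‿cong (suc× n)) ⟨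
      suc m ×′ 1# - suc n ×′ 1#          ∎
      where a = m ×′ 1# ; b = n ×′ 1#

    +-homo : ∀ i j → ⟦ i ℤ.+ j ⟧ ≈ ⟦ i ⟧ + ⟦ j ⟧
    +-homo (+ m)      (+ n)      = ×′-homo-+ 1# m n
    +-homo (+ m)      -[1+ n ]   = ⊖-homo m (suc n)
    +-homo -[1+ m ]   (+ n)      = trans (⊖-homo n (suc m)) (+-comm _ _)
    +-homo -[1+ m ]   -[1+ n ]   = begin
      - (suc (suc (m ℕ.+ n)) ×′ 1#)       ≡⟨ ≡.cong (λ k → - (suc k ×′ 1#)) (≡.sym (ℕ.+-suc m n)) ⟩
      - ((suc m ℕ.+ suc n) ×′ 1#)         ≈⟨ -‿cong (×′-homo-+ 1# (suc m) (suc n)) ⟩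
      - (suc m ×′ 1# + suc n ×′ 1#)       ≈⟨ ⁻¹-∙-comm _ _ ⟨
      - (suc m ×′ 1#) - suc n ×′ 1#       ∎

    -‿homo : ∀ i → ⟦ ℤ.- i ⟧ ≈ - ⟦ i ⟧
    -‿homo (+ zero)   = sym -0#≈0#
    -‿homo (+ suc n)  = refl
    -‿homo -[1+ n ]   = sym (-‿involutive _)

    +*-homo : ∀ m j → ⟦ + m ℤ.* j ⟧ ≈ m ×′ 1# * ⟦ j ⟧
    +*-homo m (+ n) rewrite ≡.sym (ℤ.pos-* m n) = ×′1-homo-* m n
    +*-homo m j@(-[1+ n ]) = begin
      ⟦ + m ℤ.* j ⟧                ≡⟨ ≡.cong ⟦_⟧ (≡.sym (ℤ.neg-distribʳ-* (+ m) (+ suc n))) ⟩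
      ⟦ ℤ.- (+ m ℤ.* + suc n) ⟧    ≈⟨ -‿homo (+ m ℤ.* + suc n) ⟩
      - ⟦ + m ℤ.* + suc n ⟧        ≈⟨ -‿cong (+*-homo m (+ suc n)) ⟩
      - (m ×′ 1# * suc n ×′ 1#)    ≈⟨ RingProperties.-‿distribʳ-* ring _ _ ⟩
      m ×′ 1# * ⟦ j ⟧              ∎

    *-homo : ∀ i j → ⟦ i ℤ.* j ⟧ ≈ ⟦ i ⟧ * ⟦ j ⟧
    *-homo (+ m)      j = +*-homo m j
    *-homo i@(-[1+ m ]) j = begin
      ⟦ i ℤ.* j ⟧                  ≡⟨ ≡.cong ⟦_⟧ (≡.sym (ℤ.neg-distribˡ-* (+ suc m) j)) ⟩
      ⟦ ℤ.- (+ suc m ℤ.* j) ⟧      ≈⟨ -‿homo (+ suc m ℤ.* j) ⟩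
      - ⟦ + suc m ℤ.* j ⟧          ≈⟨ -‿cong (+*-homo (suc m) j) ⟩
      - (suc m ×′ 1# * ⟦ j ⟧)      ≈⟨ -‿distribˡ-* _ _ ⟩
      ⟦ i ⟧ * ⟦ j ⟧                ∎

    homomorphism : ℤ.+-*-rawRing -Raw-AlmostCommutative⟶ fromCommutativeRing commutativeRing
    homomorphism = record
      { ⟦_⟧ = ⟦_⟧ ; +-homo = +-homo ; *-homo = *-homo ; -‿homo = -‿homo ; 0-homo = refl ; 1-homo = refl }

    _≟_ : ∀ i j → Maybe (⟦ i ⟧ ≈ ⟦ j ⟧)
    i ≟ j with i ℤ.≟ j
    ... | yes ≡.refl = just refl
    ... | no  _      = nothing

  open Algebra.Solver.Ring ℤ.+-*-rawRing (fromCommutativeRing commutativeRing)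
    IntegerCoefficients.homomorphism IntegerCoefficients._≟_
    using (solve; _:+_; _:*_; _:-_; :-_; _:=_; con)

  -- Ordered field

  poset : Poset 0ℓ 0ℓ 0ℓ
  poset = record { isPartialOrder = Structures.IsTotalOrder.isPartialOrder isTotalOrder }

  module ≤-Reasoning = PartialOrderReasoning poset

  ≤-reflexive : ∀ {x y} → x ≈ y → x ≤ y
  ≤-reflexive = Structures.IsTotalOrder.reflexive isTotalOrder

  ≤-respˡ : ∀ {x y z} → x ≈ y → x ≤ z → y ≤ z
  ≤-respˡ x≈y x≤z = ≤-trans (≤-reflexive (sym x≈y)) x≤z

  ≤-respʳ : ∀ {x y z} → x ≈ y → z ≤ x → z ≤ y
  ≤-respʳ x≈y z≤x = ≤-trans z≤x (≤-reflexive x≈y)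

  <⇒≤ : ∀ {x y} → x < y → x ≤ y
  <⇒≤ = proj₁

  <⇒≱ : ∀ {x y} → x < y → ¬ (y ≤ x)
  <⇒≱ (x≤y , x≉y) y≤x = x≉y (antisym x≤y y≤x)

  ≤⊎> : ∀ x y → x ≤ y ⊎ y < x
  ≤⊎> x y with total x y
  ... | inj₁ x≤y = inj₁ x≤y
  ... | inj₂ y≤x with em {P = y ≈ x}
  ...   | yes y≈x = inj₁ (≤-reflexive (sym y≈x))
  ...   | no  y≉x = inj₂ (y≤x , y≉x)

  trichotomy : ∀ x y → (x < y ⊎ x ≈ y) ⊎ y < x
  trichotomy x y with ≤⊎> x y
  ... | inj₂ y<x = inj₂ y<x
  ... | inj₁ x≤y with em {P = x ≈ y}
  ...   | yes x≈y = inj₁ (inj₂ x≈y)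
  ...   | no  x≉y = inj₁ (inj₁ (x≤y , x≉y))

  <-≤-trans : ∀ {x y z} → x < y → y ≤ z → x < z
  <-≤-trans x<y y≤z = ≤-trans (<⇒≤ x<y) y≤z , λ x≈z → <⇒≱ x<y (≤-respʳ (sym x≈z) y≤z)

  <-respʳ : ∀ {x y z} → y ≈ z → x < y → x < z
  <-respʳ y≈z x<y = <-≤-trans x<y (≤-reflexive y≈z)

  +-mono-≤ : ∀ {a b c d} → a ≤ b → c ≤ d → a + c ≤ b + d
  +-mono-≤ {a} {b} {c} {d} a≤b c≤d =
    ≤-trans (+-monoˡ-≤ c a≤b) (≤-respˡ (+-comm c b) (≤-respʳ (+-comm d b) (+-monoˡ-≤ b c≤d)))

  +-monoʳ-≤ : ∀ z {x y} → x ≤ y → z + x ≤ z + y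
  +-monoʳ-≤ z = +-mono-≤ ≤-refl

  +-nonNeg : ∀ {x y} → 0# ≤ x → 0# ≤ y → 0# ≤ x + y
  +-nonNeg 0≤x 0≤y = ≤-respˡ (+-identityˡ 0#) (+-mono-≤ 0≤x 0≤y)

  -- Linear and polynomial inequalities are reduced to a ring identity for
  -- the difference of the two sides.
  ≤-byDifference : ∀ {x y e} → 0# ≤ e → y ≈ x + e → x ≤ y
  ≤-byDifference {x} 0≤e y≈x+e = ≤-respʳ (sym y≈x+e) (≤-respˡ (+-identityʳ x) (+-monoʳ-≤ x 0≤e))

  x≤y⇒0≤y-x : ∀ {x y} → x ≤ y → 0# ≤ y - x
  x≤y⇒0≤y-x {x} x≤y = ≤-respˡ (-‿inverseʳ x) (+-monoˡ-≤ (- x) x≤y)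

  x<y⇒0<y-x : ∀ {x y} → x < y → 0# < y - x
  x<y⇒0<y-x {x} {y} x<y = x≤y⇒0≤y-x (<⇒≤ x<y) , λ 0≈y-x →
    proj₂ x<y (trans (trans (sym (+-identityʳ x)) (+-congˡ 0≈y-x))
      (solve 2 (λ x y → x :+ (y :- x) := y) refl x y))

  x-y≤0⇒x≤y : ∀ {x y} → x - y ≤ 0# → x ≤ y
  x-y≤0⇒x≤y {x} {y} h = ≤-byDifference (x≤y⇒0≤y-x h)
      (solve 2 (λ x y → y := x :+ (con (+ 0) :- (x :- y))) refl x y)

  neg-anti-≤ : ∀ {x y} → x ≤ y → - y ≤ - x
  neg-anti-≤ {x} {y} x≤y = ≤-byDifference (x≤y⇒0≤y-x x≤y)
      (solve 2 (λ x y → :- x := :- y :+ (y :- x)) refl x y)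

  +-cancelʳ-≤ : ∀ z {x y} → x + z ≤ y + z → x ≤ y
  +-cancelʳ-≤ z {x} {y} h = ≤-byDifference (x≤y⇒0≤y-x h)
    (solve 3 (λ x y z → y := x :+ ((y :+ z) :- (x :+ z))) refl x y z)

  ≤-minus : ∀ {x y z} → x + y ≤ z → x ≤ z - y
  ≤-minus {x} {y} {z} h = ≤-byDifference (x≤y⇒0≤y-x h)
      (solve 3 (λ x y z → z :- y := x :+ (z :- (x :+ y))) refl x y z)

  ≤-plus : ∀ {x y z} → x ≤ z - y → x + y ≤ z
  ≤-plus {x} {y} {z} h = ≤-byDifference (x≤y⇒0≤y-x h)
      (solve 3 (λ x y z → z := x :+ y :+ (z :- y :- x)) refl x y z)

  *-monoˡ-≤ : ∀ {z x y} → 0# ≤ z → x ≤ y → z * x ≤ z * y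
  *-monoˡ-≤ {z} {x} {y} 0≤z x≤y = ≤-byDifference (*-nonNeg 0≤z (x≤y⇒0≤y-x x≤y))
    (solve 3 (λ x y z → z :* y := z :* x :+ z :* (y :- x)) refl x y z)

  *-monoʳ-≤ : ∀ {z x y} → 0# ≤ z → x ≤ y → x * z ≤ y * z
  *-monoʳ-≤ {z} {x} {y} 0≤z x≤y = ≤-respˡ (*-comm z x) (≤-respʳ (*-comm z y) (*-monoˡ-≤ 0≤z x≤y))

  *-mono-≤ : ∀ {a b c d} → 0# ≤ a → 0# ≤ d → a ≤ b → c ≤ d → a * c ≤ b * d
  *-mono-≤ 0≤a 0≤d a≤b c≤d = ≤-trans (*-monoˡ-≤ 0≤a c≤d) (*-monoʳ-≤ 0≤d a≤b)

  square-nonNeg : ∀ x → 0# ≤ x * x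
  square-nonNeg x with total 0# x
  ... | inj₁ 0≤x = *-nonNeg 0≤x 0≤x
  ... | inj₂ x≤0 = ≤-respʳ (solve 1 (λ x → (:- x) :* (:- x) := x :* x) refl x) (*-nonNeg 0≤-x 0≤-x)
    where 0≤-x = ≤-respʳ (+-identityˡ (- x)) (x≤y⇒0≤y-x x≤0)

  0≤1 : 0# ≤ 1#
  0≤1 = ≤-respʳ (*-identityˡ 1#) (square-nonNeg 1#)

  0<1 : 0# < 1#
  0<1 = 0≤1 , 0≉1

  ⁻¹-inverseʳ : ∀ {x} → 0# < x → x * x ⁻¹ ≈ 1#
  ⁻¹-inverseʳ {x} 0<x with em {P = x ≈ 0#}
  ... | yes x≈0 = contradiction (sym x≈0) (proj₂ 0<x)
  ... | no x≉0  = proj₂ (inverse x≉0)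

  zero-inverse : ∀ {x} → x ≈ 0# → x ⁻¹ ≈ 0#
  zero-inverse {x} x≈0 with em {P = x ≈ 0#}
  ... | yes _  = refl
  ... | no x≉0 = contradiction x≈0 x≉0

  *-cancelˡ-≤ : ∀ {z x y} → 0# < z → z * x ≤ z * y → x ≤ y
  *-cancelˡ-≤ {z} {x} {y} 0<z zx≤zy with ≤⊎> x y
  ... | inj₁ x≤y = x≤y
  ... | inj₂ y<x = contradiction (antisym (<⇒≤ y<x)
      (≤-respˡ x≈ (≤-respʳ y≈ (*-monoˡ-≤ (x*x⁻¹≥0 ) zx≤zy)))) (proj₂ y<x)
    where
    -- This is z⁻¹ in disguise: a square times z is non-negative whatever the sign of `z ⁻¹`, which
    -- is itself derived from this lemma.
    w = z ⁻¹ * z ⁻¹ * z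
    x*x⁻¹≥0 : 0# ≤ w
    x*x⁻¹≥0 = *-nonNeg (square-nonNeg _) (<⇒≤ 0<z)
    cancel : ∀ x → w * (z * x) ≈ x
    cancel x = trans (solve 3 (λ i z x → i :* i :* z :* (z :* x) := (z :* i) :* (z :* i) :* x) refl
        (z ⁻¹) z x)
      (trans (*-congʳ (trans (*-cong (⁻¹-inverseʳ 0<z) (⁻¹-inverseʳ 0<z)) (*-identityˡ 1#)))
        (*-identityˡ x))
    x≈ = cancel x
    y≈ = cancel y

  -- The default 0⁻¹ = 0 covers the boundary case, so that quotients by a probability are
  -- non-negative even when it vanishes.
  ⁻¹-nonNeg : ∀ {x} → 0# ≤ x → 0# ≤ x ⁻¹
  ⁻¹-nonNeg {x} 0≤x with em {P = 0# ≈ x}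
  ... | yes 0≈x = ≤-reflexive (sym (zero-inverse (sym 0≈x)))
  ... | no  0≉x = *-cancelˡ-≤ (0≤x , 0≉x)
      (≤-respˡ (sym (zeroʳ x)) (≤-respʳ (sym (⁻¹-inverseʳ (0≤x , 0≉x))) 0≤1))

  *-pos : ∀ {x y} → 0# < x → 0# < y → 0# < x * y
  *-pos {x} {y} 0<x 0<y with ≤⊎> (x * y) 0#
  ... | inj₂ 0<xy = 0<xy
  ... | inj₁ xy≤0 = contradiction (*-cancelˡ-≤ 0<x (≤-respʳ (sym (zeroʳ x)) xy≤0)) (<⇒≱ 0<y)

  ⁻¹-pos : ∀ {x} → 0# < x → 0# < x ⁻¹
  ⁻¹-pos {x} 0<x with ≤⊎> (x ⁻¹) 0#
  ... | inj₂ h = h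
  ... | inj₁ h = contradiction (≤-respˡ (⁻¹-inverseʳ 0<x) (≤-respʳ (zeroʳ x) (*-monoˡ-≤ (<⇒≤ 0<x) h)))
      (<⇒≱ 0<1)

  +-pos : ∀ {x y} → 0# < x → 0# ≤ y → 0# < x + y
  +-pos {x} 0<x 0≤y = <-≤-trans 0<x (≤-respˡ (+-identityʳ x) (+-monoʳ-≤ x 0≤y))

  ÷-≤ : ∀ {x y z} → 0# < y → x ≤ z * y → x ÷ y ≤ z
  ÷-≤ {x} {y} {z} 0<y x≤zy = *-cancelˡ-≤ 0<y (≤-respˡ
    (sym (trans (solve 3 (λ x y i → y :* (x :* i) := (y :* i) :* x) refl x y (y ⁻¹))
      (trans (*-congʳ (⁻¹-inverseʳ 0<y)) (*-identityˡ x))))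
    (≤-respʳ (*-comm z y) x≤zy))

  ≤-÷ : ∀ {x y z} → 0# < y → z * y ≤ x → z ≤ x ÷ y
  ≤-÷ {x} {y} {z} 0<y zy≤x = *-cancelˡ-≤ 0<y (≤-respʳ
    (sym (trans (solve 3 (λ x y i → y :* (x :* i) := (y :* i) :* x) refl x y (y ⁻¹))
      (trans (*-congʳ (⁻¹-inverseʳ 0<y)) (*-identityˡ x))))
    (≤-respˡ (*-comm z y) zy≤x))

  ÷-* : ∀ {x y} → 0# < y → (x ÷ y) * y ≈ x
  ÷-* {x} {y} 0<y = trans (solve 3 (λ x y i → x :* i :* y := (y :* i) :* x) refl x y (y ⁻¹))
      (trans (*-congʳ (⁻¹-inverseʳ 0<y)) (*-identityˡ x))

  ÷-cancel-≤ : ∀ {x y z} → 0# < y → x ÷ y ≤ z → x ≤ z * y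
  ÷-cancel-≤ {x} {y} {z} 0<y h = ≤-respˡ (÷-* 0<y) (*-monoʳ-≤ (<⇒≤ 0<y) h)

  -- Natural numbers among the reals and the Archimedean property

  open SemiringMult semiring using (×-homo-+; ×1-homo-*)

  fromℕ-homo-+ : ∀ m n → fromℕ (m ℕ.+ n) ≈ fromℕ m + fromℕ n
  fromℕ-homo-+ = ×-homo-+ 1#

  fromℕ-nonNeg : ∀ n → 0# ≤ fromℕ n
  fromℕ-nonNeg zero    = ≤-refl
  fromℕ-nonNeg (suc n) = +-nonNeg 0≤1 (fromℕ-nonNeg n)

  fromℕ-pos : ∀ n → 0# < fromℕ (suc n)
  fromℕ-pos n = +-pos 0<1 (fromℕ-nonNeg n)

  fromℕ-mono-≤ : ∀ {m n} → m ℕ.≤ n → fromℕ m ≤ fromℕ n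
  fromℕ-mono-≤ {n = n} ℕ.z≤n = fromℕ-nonNeg n
  fromℕ-mono-≤ (ℕ.s≤s m≤n) = +-monoʳ-≤ 1# (fromℕ-mono-≤ m≤n)

  archimedean : ∀ x → ∃ λ n → x ≤ fromℕ n
  archimedean x with em {P = ∃ λ n → x ≤ fromℕ n}
  ... | yes h = h
  ... | no  h = contradiction s≤s-1 (λ p → <⇒≱ 0<1 (≤-respˡ
        (solve 1 (λ s → s :- (s :- con (+ 1)) := con (+ 1)) refl s)
          (≤-respʳ (-‿inverseʳ (s - 1#)) (+-monoˡ-≤ (- (s - 1#)) p))))
    where
    IsNatural : ℝ → Set
    IsNatural y = ∃ λ n → y ≈ fromℕ n
    natural≤x : ∀ y → IsNatural y → y ≤ x
    natural≤x y (n , y≈n) with total (fromℕ n) x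
    ... | inj₁ n≤x = ≤-respˡ (sym y≈n) n≤x
    ... | inj₂ x≤n = contradiction (n , x≤n) h
    sup = complete IsNatural (0# , 0 , refl) (x , natural≤x)
    s = proj₁ sup
    -- Every n + 1 is at most s, so s - 1 already bounds all naturals.
    s≤s-1 : s ≤ s - 1#
    s≤s-1 = proj₂ (proj₂ sup) (s - 1#) λ y (n , y≈n) →
      ≤-minus (≤-respˡ (trans (+-comm 1# (fromℕ n)) (+-congʳ (sym y≈n)))
          (proj₁ (proj₂ sup) (fromℕ (suc n)) (suc n , refl)))

  -- This takes the place of limits: an estimate of (n + 1) x whose error does not grow with n
  -- yields an estimate of x without error.
  bounded-multiples : ∀ {x y} → (∀ n → fromℕ (suc n) * x ≤ y) → x ≤ 0#
  bounded-multiples {x} {y} h with ≤⊎> x 0#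
  ... | inj₁ x≤0 = x≤0
  ... | inj₂ 0<x with archimedean (y ÷ x)
  ...   | n , y/x≤n = contradiction
          (≤-trans (≤-respˡ (trans (distribʳ x 1# (fromℕ n)) (+-congʳ (*-identityˡ x))) (h n))
            (÷-cancel-≤ 0<x y/x≤n))
          λ p → <⇒≱ 0<x (+-cancelʳ-≤ (fromℕ n * x) (≤-respʳ (sym (+-identityˡ _)) p))

  ≤-byε : ∀ {x y c} → 0# ≤ c → (∀ ε → 0# < ε → x ≤ y + c * ε) → x ≤ y
  ≤-byε {x} {y} {c} 0≤c h = x-y≤0⇒x≤y (bounded-multiples {y = c} λ n →
      let 0<N = fromℕ-pos n in
      ≤-respʳ (trans (solve 3 (λ N c i → N :* (c :* i) := (N :* i) :* c) refl (fromℕ (suc n)) c _)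
                 (trans (*-congʳ (⁻¹-inverseʳ 0<N)) (*-identityˡ c)))
        (*-monoˡ-≤ (<⇒≤ 0<N) (≤-byDifference (x≤y⇒0≤y-x (h (fromℕ (suc n) ⁻¹) (⁻¹-pos 0<N)))
           (solve 3 (λ x y z → z := (x :- y) :+ (y :+ z :- x)) refl x y (c * fromℕ (suc n) ⁻¹)))))

  -- Powers, Bernoulli's inequality and powers of two

  open Exp commutativeSemiring using (^-homo-*; ^-assocʳ; ^-distrib-*; ^-congʳ)

  ^-nonNeg : ∀ {x} n → 0# ≤ x → 0# ≤ x ^ n
  ^-nonNeg zero    0≤x = 0≤1
  ^-nonNeg (suc n) 0≤x = *-nonNeg 0≤x (^-nonNeg n 0≤x)

  ^-pos : ∀ {x} n → 0# < x → 0# < x ^ n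
  ^-pos zero    0<x = 0<1
  ^-pos (suc n) 0<x = *-pos 0<x (^-pos n 0<x)

  ^-mono-≤ : ∀ {x y} n → 0# ≤ x → x ≤ y → x ^ n ≤ y ^ n
  ^-mono-≤ zero    0≤x x≤y = ≤-refl
  ^-mono-≤ (suc n) 0≤x x≤y = *-mono-≤ 0≤x (^-nonNeg n (≤-trans 0≤x x≤y)) x≤y (^-mono-≤ n 0≤x x≤y)

  1^ : ∀ n → 1# ^ n ≈ 1#
  1^ zero    = refl
  1^ (suc n) = trans (*-identityˡ _) (1^ n)

  bernoulli : ∀ n z → 0# ≤ 1# + z → 1# + fromℕ n * z ≤ (1# + z) ^ n
  bernoulli zero    z 0≤1+z = ≤-reflexive (trans (+-congˡ (zeroˡ z)) (+-identityʳ 1#))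
  bernoulli (suc n) z 0≤1+z = ≤-trans
    (≤-byDifference (*-nonNeg (fromℕ-nonNeg n) (square-nonNeg z))
      (solve 2 (λ N z → (con (+ 1) :+ z) :* (con (+ 1) :+ N :* z) :=
        con (+ 1) :+ (con (+ 1) :+ N) :* z :+ N :* (z :* z)) refl (fromℕ n) z))
    (*-monoˡ-≤ 0≤1+z (bernoulli n z 0≤1+z))

  2# : ℝ
  2# = fromℕ 2

  1+1≈2 : 1# + 1# ≈ 2#
  1+1≈2 = +-congˡ (sym (+-identityʳ 1#))

  2*≈+ : ∀ x → 2# * x ≈ x + x
  2*≈+ x = trans (*-congʳ (sym 1+1≈2)) (trans (distribʳ x 1# 1#) (+-cong (*-identityˡ x) (*-identityˡ x)))

  0<2 : 0# < 2#
  0<2 = fromℕ-pos 1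

  1≤2^ : ∀ n → 1# ≤ 2# ^ n
  1≤2^ n = ≤-respˡ (1^ n) (^-mono-≤ n 0≤1 (≤-respˡ (+-identityʳ 1#) (fromℕ-mono-≤ {1} {2} (ℕ.s≤s ℕ.z≤n))))

  0<2^ : ∀ n → 0# < 2# ^ n
  0<2^ n = ^-pos n 0<2

  2^-mono-≤ : ∀ {m n} → m ℕ.≤ n → 2# ^ m ≤ 2# ^ n
  2^-mono-≤ {n = n} ℕ.z≤n       = 1≤2^ n
  2^-mono-≤ (ℕ.s≤s m≤n) = *-monoˡ-≤ (<⇒≤ 0<2) (2^-mono-≤ m≤n)

  2^-cancel-≤ : ∀ {m n} → 2# ^ m ≤ 2# ^ n → m ℕ.≤ n
  2^-cancel-≤ {m} {n} h with m ℕ.≤? n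
  ... | yes m≤n = m≤n
  ... | no  m≰n = contradiction
        (+-cancelʳ-≤ (2# ^ n) (≤-respʳ (sym (+-identityˡ _))
          (≤-respˡ (2*≈+ (2# ^ n)) (≤-trans (2^-mono-≤ (ℕ.≰⇒> m≰n)) h))))
        (<⇒≱ (0<2^ n))

  n≤2^n : ∀ n → fromℕ n ≤ 2# ^ n
  n≤2^n zero    = 0≤1
  n≤2^n (suc n) = ≤-respʳ (sym (2*≈+ (2# ^ n))) (+-mono-≤ (1≤2^ n) (n≤2^n n))

  -- The index i₀ excludes the value ⊥± and the bound u excludes ⊤±, so `real` never returns its
  -- default here.
  ⨆-real : ∀ {ℓ} {I : Set ℓ} (F : I → ℝ) → I → ∀ u → (∀ i → F i ≤ u) →
           (∀ i → F i ≤ real (⨆ λ i → [ F i ])) ×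
           (∀ t → (∀ i → F i ≤ t) → real (⨆ λ i → [ F i ]) ≤ t)
  ⨆-real F i₀ u F≤u with lub (λ i → [ F i ])
  ... | ⊥±    , above , least = contradiction (above i₀) [ F i₀ ]≰⊥±
  ... | ⊤±    , above , least with () ← least [ u ] (λ i → Extended.[ F≤u i ])
  ... | [ s ] , above , least =
    (λ i → [≤]-injective (above i)) , λ t F≤t → [≤]-injective (least [ t ] λ i → Extended.[ F≤t i ])

  2^≥ : ∀ x → ∃ λ k → x ≤ 2# ^ k
  2^≥ x with archimedean x
  ... | n , x≤n = n , ≤-trans x≤n (n≤2^n n)

  -- Binary logarithm

  -- A power of two above x⁻¹ does it. This makes the set of exponents defining log₂ x inhabited,
  -- and gives the dyadic bracketing a starting point at 2^0.
  log₂-lowerExponent : ∀ {x} → 0# < x → ∃ λ m → 1# ≤ 2# ^ m * x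
  log₂-lowerExponent {x} 0<x with 2^≥ (x ⁻¹)
  ... | m , x⁻¹≤ = m , ≤-respˡ (trans (*-comm _ _) (⁻¹-inverseʳ 0<x)) (*-monoʳ-≤ (<⇒≤ 0<x) x⁻¹≤)

  [2^]^ : ∀ m n → (2# ^ m) ^ n ≈ 2# ^ (m ℕ.* n)
  [2^]^ = ^-assocʳ 2#

  ^-swap : ∀ x m n → (x ^ m) ^ n ≈ (x ^ n) ^ m
  ^-swap x m n = trans (^-assocʳ x m n) (trans (^-congʳ x (ℕ.*-comm m n)) (sym (^-assocʳ x n m)))

  -- Raised to the powers N′ and N, both hypotheses contain x^(N N′), which links them. The parts m
  -- and m′ are carried to the opposite side, so that only natural exponents of 2 are compared. In
  -- effect, a rational in the lower cut of log₂ x is at most one in the upper cut.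
  cut-≤ : ∀ {x} k m n k′ m′ n′ → 0# < x →
          2# ^ k ≤ 2# ^ m * x ^ suc n → 2# ^ m′ * x ^ suc n′ ≤ 2# ^ k′ →
          (fromℕ k - fromℕ m) * fromℕ (suc n′) ≤ (fromℕ k′ - fromℕ m′) * fromℕ (suc n)
  cut-≤ {x} k m n k′ m′ n′ 0<x lower upper =
    ≤-byDifference (x≤y⇒0≤y-x real-≤)
      (solve 6 (λ k m N k′ m′ N′ → (k′ :- m′) :* N :=
         (k :- m) :* N′ :+ ((m :* N′ :+ k′ :* N) :- (k :* N′ :+ m′ :* N)))
         refl (fromℕ k) (fromℕ m) (fromℕ N) (fromℕ k′) (fromℕ m′) (fromℕ N′))
    where
    N = suc n
    N′ = suc n′
    y = (x ^ N) ^ N′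
    powers : 2# ^ (k ℕ.* N′ ℕ.+ m′ ℕ.* N) ≤ 2# ^ (m ℕ.* N′ ℕ.+ k′ ℕ.* N)
    powers = begin
      2# ^ (k ℕ.* N′ ℕ.+ m′ ℕ.* N)                      ≈⟨ ^-homo-* 2# (k ℕ.* N′) _ ⟩
      2# ^ (k ℕ.* N′) * 2# ^ (m′ ℕ.* N)                 ≈⟨ *-congʳ ([2^]^ k N′) ⟨
      (2# ^ k) ^ N′ * 2# ^ (m′ ℕ.* N)                   ≤⟨ *-monoʳ-≤ (<⇒≤ (0<2^ (m′ ℕ.* N)))
        (^-mono-≤ N′ (<⇒≤ (0<2^ k)) lower) ⟩
      (2# ^ m * x ^ N) ^ N′ * 2# ^ (m′ ℕ.* N)           ≈⟨ *-congʳ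
        (trans (^-distrib-* _ _ N′) (*-congʳ ([2^]^ m N′))) ⟩
      2# ^ (m ℕ.* N′) * y * 2# ^ (m′ ℕ.* N)             ≈⟨ *-assoc _ _ _ ⟩
      2# ^ (m ℕ.* N′) * (y * 2# ^ (m′ ℕ.* N))           ≈⟨ *-congˡ
          (trans (*-comm _ _) (*-cong (sym ([2^]^ m′ N)) (^-swap x N N′))) ⟩
      2# ^ (m ℕ.* N′) * ((2# ^ m′) ^ N * (x ^ N′) ^ N)  ≈⟨ *-congˡ (^-distrib-* _ _ N) ⟨
      2# ^ (m ℕ.* N′) * (2# ^ m′ * x ^ N′) ^ N          ≤⟨ *-monoˡ-≤ (<⇒≤ (0<2^ (m ℕ.* N′)))
                                                            (^-mono-≤ N (<⇒≤ (*-pos (0<2^ m′)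
                                                              (^-pos N′ 0<x))) upper) ⟩
      2# ^ (m ℕ.* N′) * (2# ^ k′) ^ N                   ≈⟨ *-congˡ ([2^]^ k′ N) ⟩
      2# ^ (m ℕ.* N′) * 2# ^ (k′ ℕ.* N)                 ≈⟨ ^-homo-* 2# (m ℕ.* N′) _ ⟨
      2# ^ (m ℕ.* N′ ℕ.+ k′ ℕ.* N)                      ∎
      where open ≤-Reasoning
    homo : ∀ a b c d → fromℕ (a ℕ.* b ℕ.+ c ℕ.* d) ≈ fromℕ a * fromℕ b + fromℕ c * fromℕ d
    homo a b c d = trans (fromℕ-homo-+ (a ℕ.* b) _) (+-cong (×1-homo-* a b) (×1-homo-* c d))
    real-≤ : fromℕ k * fromℕ N′ + fromℕ m′ * fromℕ N ≤ fromℕ m * fromℕ N′ + fromℕ k′ * fromℕ N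
    real-≤ = ≤-respˡ (homo k N′ m′ N)
        (≤-respʳ (homo m N′ k′ N) (fromℕ-mono-≤
          (2^-cancel-≤ {k ℕ.* N′ ℕ.+ m′ ℕ.* N} {m ℕ.* N′ ℕ.+ k′ ℕ.* N} powers)))

  log₂-isSup : ∀ {x} → 0# < x →
    (∀ k m n → 2# ^ k ≤ 2# ^ m * x ^ suc n → (fromℕ k - fromℕ m) ÷ fromℕ (suc n) ≤ log₂ x) ×
    (∀ t → (∀ k m n → 2# ^ k ≤ 2# ^ m * x ^ suc n → (fromℕ k - fromℕ m) ÷ fromℕ (suc n) ≤ t) → log₂ x ≤ t)
  log₂-isSup {x} 0<x =
    (λ k m n h → proj₁ sup ((k , m , n) , h)) , λ t ub → proj₂ sup t λ ((k , m , n) , h) → ub k m n h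
    where
    m₀ = proj₁ (log₂-lowerExponent 0<x)
    k₀ = proj₁ (2^≥ x)
    Exponent : Set
    Exponent = Σ (ℕ × ℕ × ℕ) λ (k , m , n) → 2# ^ k ≤ 2# ^ m * x ^ suc n
    value : Exponent → ℝ
    value ((k , m , n) , _) = (fromℕ k - fromℕ m) ÷ fromℕ (suc n)
    -- The rational -m₀ is a member and k₀ an upper bound, both with denominator 1.
    sup = ⨆-real value ((0 , m₀ , 0) , ≤-respʳ (*-congˡ (sym (*-identityʳ x)))
        (proj₂ (log₂-lowerExponent 0<x)))
      (fromℕ k₀ - fromℕ 0) λ ((k , m , n) , h) → ÷-≤ (fromℕ-pos n)
        (≤-respˡ (trans (*-congˡ (+-identityʳ 1#)) (*-identityʳ _)) (cut-≤ k m n k₀ 0 0 0<x h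
          (≤-respˡ (sym (trans (*-identityˡ _) (*-identityʳ x))) (proj₂ (2^≥ x)))))

  log₂-lower : ∀ {x} k m n → 0# < x → 2# ^ k ≤ 2# ^ m * x ^ suc n → fromℕ k - fromℕ m ≤ log₂ x * fromℕ
      (suc n)
  log₂-lower k m n 0<x h = ÷-cancel-≤ (fromℕ-pos n) (proj₁ (log₂-isSup 0<x) k m n h)

  -- The definition supplies lower bounds of log₂ x only; by `cut-≤` every rational of the upper cut
  -- bounds that whole set, hence its supremum.
  log₂-upper : ∀ {x} k m n → 0# < x → 2# ^ m * x ^ suc n ≤ 2# ^ k → log₂ x * fromℕ
      (suc n) ≤ fromℕ k - fromℕ m
  log₂-upper k m n 0<x h = ≤-respʳ (÷-* (fromℕ-pos n)) (*-monoʳ-≤ (fromℕ-nonNeg (suc n))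
    (proj₂ (log₂-isSup 0<x) _ λ k′ m′ n′ h′ → ÷-≤ (fromℕ-pos n′)
      (lemma (cut-≤ k′ m′ n′ k m n 0<x h′ h))))
    where
    N = fromℕ (suc n)
    lemma : ∀ {a b c} → a * N ≤ b * c → a ≤ b ÷ N * c
    lemma {a} {b} {c} h = ≤-respʳ (solve 3 (λ b c i → b :* c :* i := b :* i :* c) refl b c (N ⁻¹))
        (≤-÷ (fromℕ-pos n) h)

  log₂-mono-≤ : ∀ {x y} → 0# < x → x ≤ y → log₂ x ≤ log₂ y
  log₂-mono-≤ 0<x x≤y = proj₂ (log₂-isSup 0<x) _ λ k m n h →
    proj₁ (log₂-isSup (<-≤-trans 0<x x≤y)) k m n
      (≤-trans h (*-monoˡ-≤ (<⇒≤ (0<2^ m)) (^-mono-≤ (suc n) (<⇒≤ 0<x) x≤y)))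

  log₂-cong : ∀ {x y} → 0# < x → x ≈ y → log₂ x ≈ log₂ y
  log₂-cong 0<x x≈y = antisym (log₂-mono-≤ 0<x (≤-reflexive x≈y))
      (log₂-mono-≤ (<-respʳ x≈y 0<x) (≤-reflexive (sym x≈y)))

  dyadic-bracket : ∀ {y} → 1# ≤ y → ∀ n → y ≤ 2# ^ n → ∃ λ k → 2# ^ k ≤ y × y ≤ 2# ^ suc k
  dyadic-bracket 1≤y zero y≤1 = 0 , 1≤y , ≤-trans y≤1 (1≤2^ 1)
  dyadic-bracket {y} 1≤y (suc n) y≤2^ with total (2# ^ n) y
  ... | inj₁ 2^≤y = n , 2^≤y , y≤2^
  ... | inj₂ y≤2^n = dyadic-bracket 1≤y n y≤2^n

  -- Through `log₂-lower` and `log₂-upper` this encloses (n + 1) log₂ x in an interval of length 1,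
  -- whatever n is.
  log₂-bracket : ∀ {x} n → 0# < x → ∃₂ λ k m → 2# ^ k ≤ 2# ^ m * x ^ suc n × 2# ^ m * x ^ suc n ≤ 2# ^ suc k
  log₂-bracket {x} n 0<x =
    let m , 1≤w = log₂-lowerExponent (^-pos (suc n) 0<x)
        K , w≤2^K = 2^≥ (2# ^ m * x ^ suc n)
        k , lower , upper = dyadic-bracket 1≤w K w≤2^K
    in k , m , lower , upper

  -- Bracketing N log x, N log y and N log (x y) between consecutive integers
  -- leaves an error of at most 2 for every N.
  log₂-homo-* : ∀ {x y} → 0# < x → 0# < y → log₂ (x * y) ≈ log₂ x + log₂ y
  log₂-homo-* {x} {y} 0<x 0<y = antisym
    (x-y≤0⇒x≤y (bounded-multiples λ n → within n (upper n) (sum-lower n)))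
    (x-y≤0⇒x≤y (bounded-multiples λ n → within n (sum-upper n) (lower n)))
    where
    0<xy = *-pos 0<x 0<y
    module _ (n : ℕ) where
      N = fromℕ (suc n)
      bx = log₂-bracket n 0<x
      by = log₂-bracket n 0<y
      k = proj₁ bx
      m = proj₁ (proj₂ bx)
      l = proj₁ (proj₂ (proj₂ bx))
      u = proj₂ (proj₂ (proj₂ bx))
      k′ = proj₁ by
      m′ = proj₁ (proj₂ by)
      l′ = proj₁ (proj₂ (proj₂ by))
      u′ = proj₂ (proj₂ (proj₂ by))
      product≈ : 2# ^ (m ℕ.+ m′) * (x * y) ^ suc n ≈ (2# ^ m * x ^ suc n) * (2# ^ m′ * y ^ suc n)
      product≈ = trans (*-cong (^-homo-* 2# m m′) (^-distrib-* x y (suc n)))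
        (solve 4 (λ a b c d → a :* b :* (c :* d) := a :* c :* (b :* d)) refl (2# ^ m) (2# ^ m′)
          (x ^ suc n) (y ^ suc n))
      lower : fromℕ k + fromℕ k′ - (fromℕ m + fromℕ m′) ≤ log₂ (x * y) * N
      lower = ≤-respˡ (+-cong (fromℕ-homo-+ k k′) (-‿cong (fromℕ-homo-+ m m′)))
        (log₂-lower (k ℕ.+ k′) (m ℕ.+ m′) n 0<xy (≤-respˡ (sym (^-homo-* 2# k k′)) (≤-respʳ (sym product≈)
          (*-mono-≤ (<⇒≤ (0<2^ k)) (≤-trans (<⇒≤ (0<2^ k′)) l′) l l′))))
      upper : log₂ (x * y) * N ≤ fromℕ (suc k) + fromℕ (suc k′) - (fromℕ m + fromℕ m′)
      upper = ≤-respʳ (+-cong (fromℕ-homo-+ (suc k) (suc k′)) (-‿cong (fromℕ-homo-+ m m′)))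
        (log₂-upper (suc k ℕ.+ suc k′) (m ℕ.+ m′) n 0<xy
          (≤-respʳ (sym (^-homo-* 2# (suc k) (suc k′))) (≤-respˡ (sym product≈)
          (*-mono-≤ (≤-trans (<⇒≤ (0<2^ k)) l) (<⇒≤ (0<2^ (suc k′))) u u′))))
      sum-lower : fromℕ k + fromℕ k′ - (fromℕ m + fromℕ m′) ≤ (log₂ x + log₂ y) * N
      sum-lower = ≤-respˡ (solve 4 (λ k m k′ m′ → (k :- m) :+ (k′ :- m′) := k :+ k′ :- (m :+ m′)) refl
          (fromℕ k) (fromℕ m) (fromℕ k′) (fromℕ m′))
        (≤-respʳ (sym (distribʳ N (log₂ x) (log₂ y)))
          (+-mono-≤ (log₂-lower k m n 0<x l) (log₂-lower k′ m′ n 0<y l′)))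
      sum-upper : (log₂ x + log₂ y) * N ≤ fromℕ (suc k) + fromℕ (suc k′) - (fromℕ m + fromℕ m′)
      sum-upper = ≤-respʳ (solve 4 (λ k m k′ m′ → (k :- m) :+ (k′ :- m′) := k :+ k′ :- (m :+ m′)) refl
          (fromℕ (suc k)) (fromℕ m) (fromℕ (suc k′)) (fromℕ m′))
        (≤-respˡ (sym (distribʳ N (log₂ x) (log₂ y)))
          (+-mono-≤ (log₂-upper (suc k) m n 0<x u) (log₂-upper (suc k′) m′ n 0<y u′)))
      within : ∀ {a b} → a * N ≤ fromℕ (suc k) + fromℕ (suc k′) - (fromℕ m + fromℕ m′) →
               fromℕ k + fromℕ k′ - (fromℕ m + fromℕ m′) ≤ b * N → N * (a - b) ≤ 1# + 1#
      within {a} {b} h₁ h₂ = ≤-byDifference (+-nonNeg (x≤y⇒0≤y-x h₁) (x≤y⇒0≤y-x h₂))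
          (identity N a b (fromℕ k) (fromℕ k′) (fromℕ m + fromℕ m′))
        where
        identity : ∀ N a b k k′ m → 1# + 1# ≈ N * (a - b) +
            (((1# + k) + (1# + k′) - m - a * N) + (b * N - (k + k′ - m)))
        identity = solve 6 (λ N a b k k′ m → con (+ 1) :+ con (+ 1) := N :* (a :- b) :+
          (((con (+ 1) :+ k) :+ (con (+ 1) :+ k′) :- m :- a :* N) :+ (b :* N :- (k :+ k′ :- m)))) refl

  log₂-1 : log₂ 1# ≈ 0#
  log₂-1 = begin-equality
    log₂ 1#                           ≈⟨ solve 1 (λ l → l := l :+ l :- l) refl (log₂ 1#) ⟩
    log₂ 1# + log₂ 1# - log₂ 1#       ≈⟨ +-congʳ (log₂-homo-* 0<1 0<1) ⟨
    log₂ (1# * 1#) - log₂ 1#          ≈⟨ +-congʳ (log₂-cong (*-pos 0<1 0<1) (*-identityˡ 1#)) ⟩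
    log₂ 1# - log₂ 1#                 ≈⟨ -‿inverseʳ _ ⟩
    0#                                ∎
    where open ≤-Reasoning

  log₂-nonNeg : ∀ {x} → 1# ≤ x → 0# ≤ log₂ x
  log₂-nonNeg 1≤x = ≤-respˡ log₂-1 (log₂-mono-≤ 0<1 1≤x)

  log₂-nonPos : ∀ {x} → 0# < x → x ≤ 1# → log₂ x ≤ 0#
  log₂-nonPos 0<x x≤1 = ≤-respʳ log₂-1 (log₂-mono-≤ 0<x x≤1)

  -- Concavity of the logarithm and its tangents

  log₂-^ : ∀ {x} n → 0# < x → log₂ (x ^ n) ≈ fromℕ n * log₂ x
  log₂-^ {x} zero    0<x = trans log₂-1 (sym (zeroˡ (log₂ x)))
  log₂-^ {x} (suc n) 0<x = trans (log₂-homo-* 0<x (^-pos n 0<x)) (trans (+-congˡ (log₂-^ n 0<x))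
    (solve 2 (λ N l → l :+ N :* l := (con (+ 1) :+ N) :* l) refl (fromℕ n) (log₂ x)))

  log₂-bernoulli : ∀ n {z} → 0# < 1# + z → 0# < 1# + fromℕ n * z →
                   log₂ (1# + fromℕ n * z) ≤ fromℕ n * log₂ (1# + z)
  log₂-bernoulli n {z} 0<1+z 0<1+nz =
    ≤-respʳ (log₂-^ n 0<1+z) (log₂-mono-≤ 0<1+nz (bernoulli n z (<⇒≤ 0<1+z)))

  fromℕ-*-÷ : ∀ n x → fromℕ (suc n) * (x ÷ fromℕ (suc n)) ≈ x
  fromℕ-*-÷ n x = trans (*-comm _ _) (÷-* (fromℕ-pos n))

  -- If P a ≤ Q y, then (1 + a/Q) (1 − y/P) ≤ 1; Bernoulli's inequality carries
  -- this over to (1 + a)^P (1 − y)^Q ≤ 1.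
  log₂-concave-ℕ : ∀ p q {a y} → 0# < a → 0# < y → 0# < 1# - y →
    fromℕ (suc p) * a ≤ fromℕ (suc q) * y →
    fromℕ (suc p) * log₂ (1# + a) + fromℕ (suc q) * log₂ (1# - y) ≤ 0#
  log₂-concave-ℕ p q {a} {y} 0<a 0<y 0<1-y Pa≤Qy = begin
    P * log₂ (1# + a) + Q * log₂ (1# - y)            ≤⟨ +-mono-≤
        (*-monoˡ-≤ (fromℕ-nonNeg (suc p)) upper-a) (*-monoˡ-≤ (fromℕ-nonNeg (suc q)) upper-y) ⟩
    P * (Q * log₂ (1# + α)) + Q * (P * log₂ (1# - β))
      ≈⟨ solve 4 (λ P Q k l → P :* (Q :* k) :+ Q :* (P :* l) := P :* Q :* (k :+ l)) refl P Q
          (log₂ (1# + α)) (log₂ (1# - β)) ⟩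
    P * Q * (log₂ (1# + α) + log₂ (1# - β))          ≈⟨ *-congˡ (log₂-homo-* 0<1+α 0<1-β) ⟨
    P * Q * log₂ ((1# + α) * (1# - β))
      ≤⟨ *-monoˡ-≤ (*-nonNeg (fromℕ-nonNeg (suc p)) (fromℕ-nonNeg (suc q)))
          (log₂-nonPos (*-pos 0<1+α 0<1-β) product≤1) ⟩
    P * Q * 0#                                       ≈⟨ zeroʳ _ ⟩
    0#                                               ∎
    where
    open ≤-Reasoning
    P = fromℕ (suc p)
    Q = fromℕ (suc q)
    α = a ÷ Q
    β = y ÷ P
    0≤α : 0# ≤ α
    0≤α = ≤-÷ (fromℕ-pos q) (≤-respˡ (sym (zeroˡ Q)) (<⇒≤ 0<a))
    0≤β : 0# ≤ β
    0≤β = ≤-÷ (fromℕ-pos p) (≤-respˡ (sym (zeroˡ P)) (<⇒≤ 0<y))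
    1≤P : 1# ≤ P
    1≤P = ≤-respˡ (+-identityʳ 1#) (+-monoʳ-≤ 1# (fromℕ-nonNeg p))
    β≤y : β ≤ y
    β≤y = ÷-≤ (fromℕ-pos p) (≤-respˡ (*-identityʳ y) (*-monoˡ-≤ (<⇒≤ 0<y) 1≤P))
    0<1+α : 0# < 1# + α
    0<1+α = +-pos 0<1 0≤α
    0<1-β : 0# < 1# - β
    0<1-β = <-≤-trans 0<1-y (+-monoʳ-≤ 1# (neg-anti-≤ β≤y))
    α≤β : α ≤ β
    α≤β = ÷-≤ (fromℕ-pos q) (≤-respʳ (solve 3 (λ y i Q → Q :* y :* i := y :* i :* Q) refl y (P ⁻¹) Q)
      (≤-÷ (fromℕ-pos p) (≤-respˡ (*-comm P a) Pa≤Qy)))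
    product≤1 : (1# + α) * (1# - β) ≤ 1#
    product≤1 = ≤-byDifference (+-nonNeg (x≤y⇒0≤y-x α≤β) (*-nonNeg 0≤α 0≤β))
      (solve 2 (λ α β → con (+ 1) := (con (+ 1) :+ α) :* (con (+ 1) :- β) :+ ((β :- α) :+ α :* β)) refl α β)
    1+a≈ : 1# + Q * α ≈ 1# + a
    1+a≈ = +-congˡ (fromℕ-*-÷ q a)
    upper-a : log₂ (1# + a) ≤ Q * log₂ (1# + α)
    upper-a = ≤-respˡ (log₂-cong 0<1+Qα 1+a≈) (log₂-bernoulli (suc q) 0<1+α 0<1+Qα)
      where 0<1+Qα = <-respʳ (sym 1+a≈) (+-pos 0<1 (<⇒≤ 0<a))
    1-y≈ : 1# + P * - β ≈ 1# - y
    1-y≈ = +-congˡ (trans (solve 2 (λ P b → P :* (:- b) := :- (P :* b)) refl P β) (-‿cong (fromℕ-*-÷ p y)))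
    upper-y : log₂ (1# - y) ≤ P * log₂ (1# - β)
    upper-y = ≤-respˡ (log₂-cong 0<1-Pβ 1-y≈) (log₂-bernoulli (suc p) 0<1-β 0<1-Pβ)
      where 0<1-Pβ = <-respʳ (sym 1-y≈) 0<1-y

  ceiling : ∀ {r} → 0# ≤ r → ∃ λ n → fromℕ n ≤ r × r ≤ fromℕ (suc n)
  ceiling {r} 0≤r = let N , r≤N = archimedean r in search N r≤N
    where
    search : ∀ N → r ≤ fromℕ N → ∃ λ n → fromℕ n ≤ r × r ≤ fromℕ (suc n)
    search zero    r≤0 = 0 , 0≤r , ≤-trans r≤0 (fromℕ-nonNeg 1)
    search (suc N) r≤N+1 with total (fromℕ N) r
    ... | inj₁ N≤r = N , N≤r , r≤N+1
    ... | inj₂ r≤N = search N r≤N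

  -- For real a and y the ratio a/y lies between q/P and (q + 1)/P, and the integer case applies to
  -- P and q + 1. Rounding costs at most -y log₂ (1 - y) in P times the claim, an error independent
  -- of P.
  log₂-concave : ∀ {a y} → 0# < a → 0# < y → 0# < 1# - y →
    y * log₂ (1# + a) + a * log₂ (1# - y) ≤ 0#
  log₂-concave {a} {y} 0<a 0<y 0<1-y = bounded-multiples λ p →
    let P = fromℕ (suc p)
        q , q≤Pa/y , Pa/y≤q+1 = ceiling
            (≤-÷ {P * a} {y} {0#} 0<y (≤-respˡ (sym (zeroˡ y)) (*-nonNeg (fromℕ-nonNeg (suc p)) (<⇒≤ 0<a))))
        qy≤Pa : fromℕ q * y ≤ P * a
        qy≤Pa = ≤-respʳ (÷-* 0<y) (*-monoʳ-≤ (<⇒≤ 0<y) q≤Pa/y)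
    in ≤-byDifference
      (+-nonNeg (*-nonNeg (<⇒≤ 0<y) (x≤y⇒0≤y-x
        (log₂-concave-ℕ p q 0<a 0<y 0<1-y (÷-cancel-≤ 0<y Pa/y≤q+1))))
        (*-nonNeg (x≤y⇒0≤y-x qy≤Pa) (x≤y⇒0≤y-x (log₂-nonPos 0<1-y 1-y≤1))))
      (identity P (fromℕ q) a y (log₂ (1# + a)) (log₂ (1# - y)))
    where
    1-y≤1 : 1# - y ≤ 1#
    1-y≤1 = ≤-byDifference (<⇒≤ 0<y) (solve 1 (λ y → con (+ 1) := con (+ 1) :- y :+ y) refl y)
    identity : ∀ P q a y k l → y * - l ≈ P * (y * k + a * l) +
        (y * (0# - (P * k + (1# + q) * l)) + (P * a - q * y) * (0# - l))
    identity = solve 6 (λ P q a y k l → y :* (:- l) :=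
      P :* (y :* k :+ a :* l) :+ (y :* (con (+ 0) :- (P :* k :+ (con (+ 1) :+ q) :* l)) :+
          (P :* a :- q :* y) :* (con (+ 0) :- l))) refl

  -- Concavity in terms of chords ending at 1. It serves twice: one left slope bounds all right
  -- slopes, so their supremum exists, and that supremum is then below every left slope.
  log₂-slopes : ∀ {a y} → 0# < a → 0# < y → 0# < 1# - y → log₂ (1# + a) ÷ a ≤ (- log₂ (1# - y)) ÷ y
  log₂-slopes {a} {y} 0<a 0<y 0<1-y = ÷-≤ 0<a
    (≤-respʳ (solve 3 (λ l a i → l :* a :* i := l :* i :* a) refl (- log₂ (1# - y)) a (y ⁻¹))
      (≤-÷ 0<y (≤-byDifference (x≤y⇒0≤y-x (log₂-concave 0<a 0<y 0<1-y))
        (solve 4 (λ a y k l → (:- l) :* a := k :* y :+ (con (+ 0) :- (y :* k :+ a :* l))) refl a y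
          (log₂ (1# + a)) (log₂ (1# - y))))))

  -- The constant is log₂ e, obtained as the supremum of the slopes of the
  -- chords of log₂ to the right of 1.
  log₂-tangent : ∃ λ c → 0# ≤ c × (∀ {t} → 0# < t → log₂ t ≤ c * (t - 1#))
  log₂-tangent = c , 0≤c , tangent
    where
    IsSlope : ℝ → Set
    IsSlope z = ∃ λ a → 0# < a × z ≈ log₂ (1# + a) ÷ a
    -- The chord from 1/2 to 1 is the left chord whose slope bounds the set.
    h = 2# ⁻¹
    0<h = ⁻¹-pos 0<2
    h≈1-h : h ≈ 1# - h
    h≈1-h = trans (solve 1 (λ h → h := h :+ h :- h) refl h)
        (+-congʳ (trans (sym (2*≈+ h)) (⁻¹-inverseʳ 0<2)))
    sup = complete IsSlope (log₂ (1# + 1#) ÷ 1# , 1# , 0<1 , refl) ((- log₂ (1# - h)) ÷ h ,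
      λ z (a , 0<a , z≈) → ≤-respˡ (sym z≈) (log₂-slopes 0<a 0<h (<-respʳ h≈1-h 0<h)))
    c = proj₁ sup
    slope≤c : ∀ {a} → 0# < a → log₂ (1# + a) ÷ a ≤ c
    slope≤c 0<a = proj₁ (proj₂ sup) _ (_ , 0<a , refl)
    0≤c : 0# ≤ c
    0≤c = ≤-trans (≤-÷ {log₂ (1# + 1#)} 0<1
        (≤-respˡ (sym (zeroˡ 1#)) (log₂-nonNeg (≤-respˡ (+-identityʳ 1#) (+-monoʳ-≤ 1# 0≤1)))))
          (slope≤c 0<1)
    right : ∀ {t} → 1# < t → log₂ t ≤ c * (t - 1#)
    right {t} 1<t = ≤-respˡ (log₂-cong (+-pos 0<1 (<⇒≤ (x<y⇒0<y-x 1<t)))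
        (solve 1 (λ t → con (+ 1) :+ (t :- con (+ 1)) := t) refl t))
      (÷-cancel-≤ (x<y⇒0<y-x 1<t) (slope≤c (x<y⇒0<y-x 1<t)))
    left : ∀ {t} → 0# < t → t < 1# → log₂ t ≤ c * (t - 1#)
    left {t} 0<t t<1 = ≤-byDifference (x≤y⇒0≤y-x c*y≤)
      (solve 3 (λ t c l → c :* (t :- con (+ 1)) := l :+ (:- l :- c :* (con (+ 1) :- t))) refl t c (log₂ t))
      where
      0<1-t = x<y⇒0<y-x t<1
      1-[1-t] : 1# - (1# - t) ≈ t
      1-[1-t] = solve 1 (λ t → con (+ 1) :- (con (+ 1) :- t) := t) refl t
      0<1-[1-t] = <-respʳ (sym 1-[1-t]) 0<t
      c≤ : c ≤ (- log₂ (1# - (1# - t))) ÷ (1# - t)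
      c≤ = proj₂ (proj₂ sup) _ λ z (a , 0<a , z≈) → ≤-respˡ (sym z≈) (log₂-slopes 0<a 0<1-t 0<1-[1-t])
      c*y≤ : c * (1# - t) ≤ - log₂ t
      c*y≤ = ≤-respʳ (trans (÷-* 0<1-t) (-‿cong (log₂-cong 0<1-[1-t] 1-[1-t]))) (*-monoʳ-≤ (<⇒≤ 0<1-t) c≤)
    at-1 : ∀ {t} → 0# < t → t ≈ 1# → log₂ t ≤ c * (t - 1#)
    at-1 0<t t≈1 = ≤-reflexive (trans (log₂-cong 0<t t≈1) (trans log₂-1
      (sym (trans (*-congˡ (trans (+-congʳ t≈1) (-‿inverseʳ 1#))) (zeroʳ c)))))
    tangent : ∀ {t} → 0# < t → log₂ t ≤ c * (t - 1#)
    tangent {t} 0<t = [ [ left 0<t , at-1 0<t ]′ , right ]′ (trichotomy t 1#)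

  -- The tangent at 1 is moved to s by writing u as s times u/s; the same c works for all s.
  log₂-below-tangent : ∃ λ c → 0# ≤ c × (∀ {u s} → 0# < u → 0# < s → log₂ u ≤ log₂ s + c * (u ÷ s - 1#))
  log₂-below-tangent = let c , 0≤c , tangent = log₂-tangent in c , 0≤c , λ {u} {s} 0<u 0<s →
    let 0<u/s = *-pos 0<u (⁻¹-pos 0<s) in
    ≤-respˡ (trans (sym (log₂-homo-* 0<s 0<u/s))
        (log₂-cong (*-pos 0<s 0<u/s) (trans (*-comm _ _) (÷-* 0<s))))
      (+-monoʳ-≤ (log₂ s) (tangent 0<u/s))

  -- Sums of non-negative families

  -- A plain sum, so that a case distinction leaves the `em` inside `𝟙` alone and `𝟙-true` and
  -- `𝟙-false` can rewrite it.
  decide : (E : Set) → E ⊎ ¬ E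
  decide E with em {P = E}
  ... | yes e = inj₁ e
  ... | no ¬e = inj₂ ¬e

  𝟙-true : ∀ {E : Set} → E → 𝟙 E ≈ 1#
  𝟙-true {E} e with em {P = E}
  ... | yes _  = refl
  ... | no  ¬e = contradiction e ¬e

  𝟙-false : ∀ {E : Set} → ¬ E → 𝟙 E ≈ 0#
  𝟙-false {E} ¬e with em {P = E}
  ... | yes e = contradiction e ¬e
  ... | no  _ = refl

  0≤𝟙 : ∀ (E : Set) → 0# ≤ 𝟙 E
  0≤𝟙 E with em {P = E}
  ... | yes _ = 0≤1
  ... | no  _ = ≤-refl

  𝟙≤1 : ∀ (E : Set) → 𝟙 E ≤ 1#
  𝟙≤1 E with em {P = E}
  ... | yes _ = ≤-refl
  ... | no  _ = 0≤1

  *𝟙-true : ∀ {x} {E : Set} → E → x * 𝟙 E ≈ x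
  *𝟙-true e = trans (*-congˡ (𝟙-true e)) (*-identityʳ _)

  *𝟙-false : ∀ {x} {E : Set} → ¬ E → x * 𝟙 E ≈ 0#
  *𝟙-false ¬e = trans (*-congˡ (𝟙-false ¬e)) (zeroʳ _)

  *𝟙-nonNeg : ∀ {x} (E : Set) → 0# ≤ x → 0# ≤ x * 𝟙 E
  *𝟙-nonNeg E 0≤x = *-nonNeg 0≤x (0≤𝟙 E)

  *𝟙-≤ : ∀ {x} (E : Set) → 0# ≤ x → x * 𝟙 E ≤ x
  *𝟙-≤ E 0≤x = ≤-respʳ (*-identityʳ _) (*-monoˡ-≤ 0≤x (𝟙≤1 E))

  -- Finite sums over lists

  finiteSum-mono : ∀ {f g : A → ℝ} xs → (∀ a → a ∈ xs → f a ≤ g a) → finiteSum f xs ≤ finiteSum g xs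
  finiteSum-mono []       f≤g = ≤-refl
  finiteSum-mono (x ∷ xs) f≤g = +-mono-≤ (f≤g x (here ≡.refl)) (finiteSum-mono xs λ a a∈ → f≤g a (there a∈))

  finiteSum-0 : ∀ (xs : List A) → finiteSum (λ _ → 0#) xs ≈ 0#
  finiteSum-0 []       = refl
  finiteSum-0 (x ∷ xs) = trans (+-identityˡ _) (finiteSum-0 xs)

  finiteSum-const : ∀ c (xs : List A) → finiteSum (λ _ → c) xs ≈ fromℕ (length xs) * c
  finiteSum-const c []       = sym (zeroˡ c)
  finiteSum-const c (x ∷ xs) = trans (+-cong (sym (*-identityˡ c)) (finiteSum-const c xs))
      (sym (distribʳ c 1# _))

  finiteSum-+ : ∀ (f g : A → ℝ) xs → finiteSum (λ a → f a + g a) xs ≈ finiteSum f xs + finiteSum g xs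
  finiteSum-+ f g []       = sym (+-identityˡ 0#)
  finiteSum-+ f g (x ∷ xs) = trans (+-congˡ (finiteSum-+ f g xs))
    (solve 4 (λ a b c d → a :+ b :+ (c :+ d) := a :+ c :+ (b :+ d)) refl (f x) (g x) (finiteSum f xs)
      (finiteSum g xs))

  finiteSum-* : ∀ c (f : A → ℝ) xs → finiteSum (λ a → c * f a) xs ≈ c * finiteSum f xs
  finiteSum-* c f []       = sym (zeroʳ c)
  finiteSum-* c f (x ∷ xs) = trans (+-congˡ (finiteSum-* c f xs)) (sym (distribˡ c _ _))

  finiteSum-swap : ∀ (f : A → B → ℝ) xs ys →
    finiteSum (λ a → finiteSum (f a) ys) xs ≈ finiteSum (λ b → finiteSum (λ a → f a b) xs) ys
  finiteSum-swap f []       ys = sym (finiteSum-0 ys)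
  finiteSum-swap f (x ∷ xs) ys = trans (+-congˡ (finiteSum-swap f xs ys)) (sym (finiteSum-+ (f x) _ ys))

  finiteSum-++ : ∀ (f : A → ℝ) xs ys → finiteSum f (xs ++ ys) ≈ finiteSum f xs + finiteSum f ys
  finiteSum-++ f []       ys = sym (+-identityˡ _)
  finiteSum-++ f (x ∷ xs) ys = trans (+-congˡ (finiteSum-++ f xs ys)) (sym (+-assoc _ _ _))

  finiteSum-nonNeg : ∀ {f : A → ℝ} → (∀ a → 0# ≤ f a) → ∀ xs → 0# ≤ finiteSum f xs
  finiteSum-nonNeg 0≤f []       = ≤-refl
  finiteSum-nonNeg 0≤f (x ∷ xs) = +-nonNeg (0≤f x) (finiteSum-nonNeg 0≤f xs)

  -- Each entry of xs is cancelled against one occurrence in ys. As xs has no repetitions, its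
  -- remaining entries survive the deletion; what is left of ys at the end sums to something
  -- non-negative.
  finiteSum-⊆ : ∀ {f : A → ℝ} → (∀ a → 0# ≤ f a) → ∀ {xs ys} → Unique xs → xs ⊆ ys →
      finiteSum f xs ≤ finiteSum f ys
  finiteSum-⊆ 0≤f {[]} {ys} _ _ = finiteSum-nonNeg 0≤f ys
  finiteSum-⊆ {f = f} 0≤f {x ∷ xs} {ys} (x≢xs ∷ uxs) xs⊆ys with ∈-∃++ (xs⊆ys (here ≡.refl))
  ... | as , bs , ≡.refl = ≤-respʳ move (+-monoʳ-≤ (f x) (finiteSum-⊆ 0≤f uxs xs⊆))
    where
    xs⊆ : xs ⊆ as ++ bs
    xs⊆ {y} y∈xs with ∈-++⁻ as (xs⊆ys (there y∈xs))
    ... | inj₁ y∈as            = ∈-++⁺ˡ y∈as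
    ... | inj₂ (here ≡.refl)   = contradiction y∈xs (All¬⇒¬Any x≢xs)
    ... | inj₂ (there y∈bs)    = ∈-++⁺ʳ as y∈bs
    move : f x + finiteSum f (as ++ bs) ≈ finiteSum f (as ++ x ∷ bs)
    move = trans (+-congˡ (finiteSum-++ f as bs)) (trans
      (solve 3 (λ a b c → a :+ (b :+ c) := b :+ (a :+ c)) refl (f x) (finiteSum f as) (finiteSum f bs))
      (sym (finiteSum-++ f as (x ∷ bs))))

  ≤-finiteSum : ∀ {f : A → ℝ} → (∀ a → 0# ≤ f a) → ∀ {x xs} → x ∈ xs → f x ≤ finiteSum f xs
  ≤-finiteSum 0≤f {x} x∈xs = ≤-respˡ (+-identityʳ _)
      (finiteSum-⊆ 0≤f {x ∷ []} ([] ∷ []) λ { (here ≡.refl) → x∈xs })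

  _≟_ : DecidableEquality A
  x ≟ y = em

  nub : List A → List A
  nub = deduplicate _≟_

  nub-unique : ∀ (xs : List A) → Unique (nub xs)
  nub-unique = UniqueDec.deduplicate-! _≟_

  ∈-nub : ∀ {x : A} {xs} → x ∈ xs → x ∈ nub xs
  ∈-nub = ∈-deduplicate⁺ _≟_

  ∈-nub-++ˡ : ∀ {x : A} {xs ys} → x ∈ xs → x ∈ nub (xs ++ ys)
  ∈-nub-++ˡ x∈xs = ∈-nub (∈-++⁺ˡ x∈xs)

  ∈-nub-++ʳ : ∀ {x : A} xs {ys} → x ∈ ys → x ∈ nub (xs ++ ys)
  ∈-nub-++ʳ xs x∈ys = ∈-nub (∈-++⁺ʳ xs x∈ys)

  -- Infinite sums as suprema of partial sums

  NonNegative : (A → ℝ) → Set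
  NonNegative f = ∀ a → 0# ≤ f a

  Bounded : (A → ℝ) → ℝ → Set
  Bounded f C = ∀ G → Unique G → finiteSum f G ≤ C

  -- For non-negative families the unconditional sum is the supremum of the
  -- finite partial sums, which spares all ε-arguments.
  IsSum : (A → ℝ) → ℝ → Set
  IsSum f s = Bounded f s × (∀ C → Bounded f C → s ≤ C)

  Bounded-mono : ∀ {f g : A → ℝ} {C} → (∀ a → f a ≤ g a) → Bounded g C → Bounded f C
  Bounded-mono f≤g g≤C G uG = ≤-trans (finiteSum-mono G λ a _ → f≤g a) (g≤C G uG)

  Bounded-weaken : ∀ {f : A → ℝ} {C D} → C ≤ D → Bounded f C → Bounded f D
  Bounded-weaken C≤D f≤C G uG = ≤-trans (f≤C G uG) C≤D

  Bounded⇒nonNeg : ∀ {f : A → ℝ} {C} → Bounded f C → 0# ≤ C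
  Bounded⇒nonNeg f≤C = f≤C [] []

  Bounded⇒≤ : ∀ {f : A → ℝ} {C} → Bounded f C → ∀ a → f a ≤ C
  Bounded⇒≤ f≤C a = ≤-respˡ (+-identityʳ _) (f≤C (a ∷ []) ([] ∷ []))

  IsSum-cong : ∀ {f g : A → ℝ} {s t} → (∀ a → f a ≈ g a) → s ≈ t → IsSum f s → IsSum g t
  IsSum-cong f≈g s≈t (f≤s , least) =
    Bounded-mono (λ a → ≤-reflexive (sym (f≈g a))) (Bounded-weaken (≤-reflexive s≈t) f≤s) ,
    λ C g≤C → ≤-respˡ s≈t (least C (Bounded-mono (λ a → ≤-reflexive (f≈g a)) g≤C))

  IsSum-mono : ∀ {f g : A → ℝ} {s t} → (∀ a → f a ≤ g a) → IsSum f s → IsSum g t → s ≤ t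
  IsSum-mono f≤g (_ , least) (g≤t , _) = least _ (Bounded-mono f≤g g≤t)

  IsSum-exists : ∀ {f : A → ℝ} {C} → Bounded f C → ∃ (IsSum f)
  IsSum-exists {f = f} {C} f≤C = let s , above , least = sup in
    s , (λ G uG → above _ (G , uG , refl)) , λ D f≤D → least D λ x (G , uG , x≈) → ≤-respˡ (sym x≈)
        (f≤D G uG)
    where
    sup = complete (λ x → ∃ λ G → Unique G × x ≈ finiteSum f G) (0# , [] , [] , refl)
            (C , λ x (G , uG , x≈) → ≤-respˡ (sym x≈) (f≤C G uG))

  -- Joining the list F that belongs to ε to a given G does not lower the partial sum and brings it
  -- within ε of s.
  HasSum⇒IsSum : ∀ {f : A → ℝ} {s} → NonNegative f → HasSum f s → IsSum f s
  HasSum⇒IsSum {f = f} {s} 0≤f hs = bounded , least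
    where
    bounded : Bounded f s
    bounded G uG = ≤-byε 0≤1 λ ε 0<ε → let F , close = hs ε 0<ε in
      ≤-respʳ (+-congˡ (sym (*-identityˡ ε))) (≤-trans (finiteSum-⊆ 0≤f uG (∈-nub-++ʳ F))
        (proj₂ (close (nub (F ++ G)) (nub-unique _) ∈-nub-++ˡ)))
    least : ∀ C → Bounded f C → s ≤ C
    least C f≤C = ≤-byε 0≤1 λ ε 0<ε → let F , close = hs ε 0<ε in
      ≤-byDifference (+-nonNeg (x≤y⇒0≤y-x (f≤C (nub F) (nub-unique F)))
          (x≤y⇒0≤y-x (proj₁ (close (nub F) (nub-unique F) ∈-nub))))
        (solve 4 (λ s C ε x → C :+ con (+ 1) :* ε := s :+ ((C :- x) :+ (x :- (s :- ε)))) refl s C ε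
          (finiteSum f (nub F)))

  -- Some partial sum must reach s - ε, since otherwise s - ε would be a smaller bound; by
  -- non-negativity all larger lists stay above it.
  IsSum⇒HasSum : ∀ {f : A → ℝ} {s} → NonNegative f → IsSum f s → HasSum f s
  IsSum⇒HasSum {f = f} {s} 0≤f (f≤s , least) ε 0<ε with em {P = ∃ λ F → Unique F × s - ε ≤ finiteSum f F}
  ... | yes (F , uF , s-ε≤F) = F , λ G uG F⊆G →
          ≤-trans s-ε≤F (finiteSum-⊆ 0≤f uF F⊆G) ,
          ≤-trans (f≤s G uG) (≤-byDifference (<⇒≤ 0<ε) refl)
  ... | no  none = contradiction (least (s - ε) below) λ s≤s-ε → <⇒≱ 0<ε
          (≤-byDifference (x≤y⇒0≤y-x s≤s-ε) (solve 2 (λ s ε → con (+ 0) := ε :+ ((s :- ε) :- s)) refl s ε))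
    where
    below : Bounded f (s - ε)
    below G uG = [ (λ h → contradiction (G , uG , h) none) , id ]′ (total (s - ε) (finiteSum f G))

  ∑-unique : ∀ {f : A → ℝ} {s} → NonNegative f → IsSum f s → ∑ f ≈ s
  ∑-unique {f = f} 0≤f sf@(f≤s , least) with em {P = ∃ (HasSum f)}
  ... | yes (t , ht) = let f≤t , least′ = HasSum⇒IsSum 0≤f ht in antisym (least′ _ f≤s) (least _ f≤t)
  ... | no  none     = contradiction (_ , IsSum⇒HasSum 0≤f sf) none

  ∑-isSum : ∀ {f : A → ℝ} {C} → NonNegative f → Bounded f C → IsSum f (∑ f)
  ∑-isSum 0≤f f≤C = let s , sf = IsSum-exists f≤C in IsSum-cong (λ _ → refl) (sym (∑-unique 0≤f sf)) sf

  -- The two suprema are taken over independent lists G and H; both partial sums are dominated on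
  -- the union of G and H, where the bound C applies to f + g.
  IsSum-+ : ∀ {f g : A → ℝ} {s t} → NonNegative f → NonNegative g → IsSum f s → IsSum g t → IsSum
      (λ a → f a + g a) (s + t)
  IsSum-+ {f = f} {g} {s} {t} 0≤f 0≤g (f≤s , f-least) (g≤t , g-least) =
    (λ G uG → ≤-respˡ (sym (finiteSum-+ f g G)) (+-mono-≤ (f≤s G uG) (g≤t G uG))) ,
    λ C fg≤C → ≤-plus (f-least _ λ G uG → ≤-minus
        (≤-respˡ (+-comm t _) (≤-plus (g-least _ λ H uH → ≤-minus (
      let U = nub (G ++ H) in
      ≤-trans (≤-respˡ (+-comm _ _) (+-mono-≤ (finiteSum-⊆ 0≤f uG ∈-nub-++ˡ)
          (finiteSum-⊆ 0≤g uH (∈-nub-++ʳ G))))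
        (≤-respˡ (finiteSum-+ f g U) (fg≤C U (nub-unique _))))))))

  IsSum-0 : IsSum {A} (λ _ → 0#) 0#
  IsSum-0 = (λ G _ → ≤-reflexive (finiteSum-0 G)) , λ C → Bounded⇒nonNeg

  IsSum-finiteSum : ∀ {f : B → A → ℝ} {s : B → ℝ} → (∀ b → NonNegative (f b)) → (∀ b → IsSum (f b) (s b)) →
    ∀ G → IsSum (λ a → finiteSum (λ b → f b a) G) (finiteSum s G)
  IsSum-finiteSum 0≤f sf []      = IsSum-0
  IsSum-finiteSum 0≤f sf (b ∷ G) = IsSum-+ (0≤f b) (λ a → finiteSum-nonNeg (λ b → 0≤f b a) G) (sf b)
      (IsSum-finiteSum 0≤f sf G)

  IsSum-* : ∀ {f : A → ℝ} {c s} → 0# ≤ c → IsSum f s → IsSum (λ a → c * f a) (c * s)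
  IsSum-* {f = f} {c} {s} 0≤c (f≤s , least) =
    (λ G uG → ≤-respˡ (sym (finiteSum-* c f G)) (*-monoˡ-≤ 0≤c (f≤s G uG))) , cases (em {P = 0# ≈ c})
    where
    cases : _ → ∀ C → Bounded (λ a → c * f a) C → c * s ≤ C
    cases (yes 0≈c) C cf≤C = ≤-respˡ (trans (sym (zeroˡ s)) (*-congʳ 0≈c)) (Bounded⇒nonNeg cf≤C)
    cases (no  0≉c) C cf≤C = ≤-respˡ (*-comm s c) (≤-respʳ (÷-* 0<c) (*-monoʳ-≤ 0≤c (least (C ÷ c) λ G uG →
      ≤-÷ 0<c (≤-respˡ (trans (finiteSum-* c f G) (*-comm c _)) (cf≤C G uG)))))
      where 0<c = 0≤c , 0≉c

  finiteSum-indicator-∉ : ∀ r {x : A} {G} → x ∉ G → finiteSum (λ b → r * 𝟙 (x ≡ b)) G ≈ 0#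
  finiteSum-indicator-∉ r {G = []}    x∉G = refl
  finiteSum-indicator-∉ r {G = b ∷ G} x∉G =
    trans (+-cong (*𝟙-false (x∉G ∘ here)) (finiteSum-indicator-∉ r (x∉G ∘ there))) (+-identityˡ 0#)

  finiteSum-indicator-≤ : ∀ {r} → 0# ≤ r → ∀ (x : A) {G} → Unique G → finiteSum (λ b → r * 𝟙 (x ≡ b)) G ≤ r
  finiteSum-indicator-≤ 0≤r x {[]}    _           = 0≤r
  finiteSum-indicator-≤ {r = r} 0≤r x {b ∷ G} (b≢G ∷ uG) with decide (x ≡ b)
  ... | inj₁ ≡.refl = ≤-reflexive
      (trans (+-cong (*𝟙-true ≡.refl) (finiteSum-indicator-∉ r (All¬⇒¬Any b≢G))) (+-identityʳ r))
  ... | inj₂ x≢b    = ≤-respˡ (sym (trans (+-congʳ (*𝟙-false x≢b)) (+-identityˡ _)))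
      (finiteSum-indicator-≤ 0≤r x uG)

  -- Partitioning a family along a map replaces Tonelli's theorem.
  module Fibres {f : A → ℝ} (0≤f : NonNegative f) (h : A → B) where

    fibre : B → A → ℝ
    fibre b a = f a * 𝟙 (h a ≡ b)

    fibre-nonNeg : ∀ b → NonNegative (fibre b)
    fibre-nonNeg b a = *𝟙-nonNeg (h a ≡ b) (0≤f a)

    fromFibres : ∀ {g C} → (∀ b → Bounded (fibre b) (g b)) → Bounded g C → Bounded f C
    fromFibres {g} {C} fibre≤g g≤C K uK = begin
      finiteSum f K                                              ≤⟨ finiteSum-mono K
          (λ a a∈K → ≤-respˡ (*𝟙-true ≡.refl)
                                                                      (≤-finiteSum (λ b → fibre-nonNeg b
                                                                        a) {h a} (∈-nub (∈-map⁺ h a∈K)))) ⟩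
      finiteSum (λ a → finiteSum (λ b → fibre b a) G) K          ≈⟨ finiteSum-swap (λ a b → fibre b a) K G ⟩
      finiteSum (λ b → finiteSum (fibre b) K) G                  ≤⟨ finiteSum-mono G
          (λ b _ → fibre≤g b K uK) ⟩
      finiteSum g G                                              ≤⟨ g≤C G (nub-unique (map h K)) ⟩
      C                                                          ∎
      where
      open ≤-Reasoning
      G = nub (map h K)

    -- A finite sum of fibre sums is the sum of one combined family. Since the entries of G are
    -- distinct, each point is counted in at most one fibre, so this family lies below `f`.
    toFibres : ∀ {g C} → (∀ b → IsSum (fibre b) (g b)) → Bounded f C → Bounded g C
    toFibres sg f≤C G uG = proj₂ (IsSum-finiteSum fibre-nonNeg sg G) _
      (Bounded-mono (λ a → finiteSum-indicator-≤ (0≤f a) (h a) uG) f≤C)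

    IsSum-toFibres : ∀ {g s} → (∀ b → IsSum (fibre b) (g b)) → IsSum f s → IsSum g s
    IsSum-toFibres sg (f≤s , least) = toFibres sg f≤s , λ C g≤C → least C (fromFibres (proj₁ ∘ sg) g≤C)

    IsSum-fromFibres : ∀ {g s} → (∀ b → IsSum (fibre b) (g b)) → IsSum g s → IsSum f s
    IsSum-fromFibres sg (g≤s , least) = fromFibres (proj₁ ∘ sg) g≤s , λ C f≤C → least C (toFibres sg f≤C)

  IsSum-single : ∀ {f : A → ℝ} a → NonNegative f → (∀ b → a ≢ b → f b ≈ 0#) → IsSum f (f a)
  IsSum-single {f = f} a 0≤f f≈0 =
    (λ G uG → ≤-trans (finiteSum-mono G λ b _ → f≤ b) (finiteSum-indicator-≤ (0≤f a) a uG)) , λ C f≤C →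
      Bounded⇒≤ f≤C a
    where
    f≤ : ∀ b → f b ≤ f a * 𝟙 (a ≡ b)
    f≤ b with decide (a ≡ b)
    ... | inj₁ ≡.refl = ≤-reflexive (sym (*𝟙-true ≡.refl))
    ... | inj₂ a≢b    = ≤-reflexive (trans (f≈0 b a≢b) (sym (*𝟙-false a≢b)))

  -- The fibres of an injection are points or empty, so `g` gives exactly the fibre sums of `f`.
  -- This is how a single row or column is placed inside a product.
  module Extension {f : A → ℝ} {g : B → ℝ} (0≤f : NonNegative f) (h : A → B)
                   (injective : ∀ {a a′} → h a ≡ h a′ → a ≡ a′)
                   (g∘h≈f : ∀ a → g (h a) ≈ f a) (g≈0 : ∀ b → (∀ a → h a ≢ b) → g b ≈ 0#) where
    open Fibres 0≤f h

    fibre-isSum : ∀ b → IsSum (fibre b) (g b)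
    fibre-isSum b with em {P = ∃ λ a → h a ≡ b}
    ... | yes (a , ≡.refl) = IsSum-cong (λ _ → refl) (trans (*𝟙-true ≡.refl) (sym (g∘h≈f a)))
            (IsSum-single a (fibre-nonNeg b) λ a′ a≢a′ → *𝟙-false (λ eq → a≢a′ (injective (≡.sym eq))))
    ... | no  none = IsSum-cong (λ a → sym (*𝟙-false λ eq → none (a , eq)))
        (sym (g≈0 b λ a eq → none (a , eq))) IsSum-0

    Bounded-extension : ∀ {C} → Bounded f C → Bounded g C
    Bounded-extension = toFibres fibre-isSum

    IsSum-extension : ∀ {s} → IsSum f s → IsSum g s
    IsSum-extension = IsSum-toFibres fibre-isSum

  -- Double sums over products

  module _ {f : A × B → ℝ} (0≤f : NonNegative f) where

    -- By definition the fibre of `proj₁` over a, which lets `Fibres` act on rows.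
    row : A → A × B → ℝ
    row a x = f x * 𝟙 (proj₁ x ≡ a)

    column : B → A × B → ℝ
    column b x = f x * 𝟙 (proj₂ x ≡ b)

    row-off : ∀ a x → (∀ b → (a , b) ≢ x) → row a x ≈ 0#
    row-off a (a′ , b) x∉row = *𝟙-false λ { ≡.refl → x∉row b ≡.refl }

    column-off : ∀ b x → (∀ a → (a , b) ≢ x) → column b x ≈ 0#
    column-off b (a , b′) x∉column = *𝟙-false λ { ≡.refl → x∉column a ≡.refl }

    module Row (a : A) = Extension {f = λ b → f (a , b)} {g = row a} (λ b → 0≤f (a , b)) (a ,_)
      ,-injectiveʳ (λ b → *𝟙-true ≡.refl) (row-off a)

    module Column (b : B) = Extension {f = λ a → f (a , b)} {g = column b} (λ a → 0≤f (a , b)) (_, b)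
      ,-injectiveˡ (λ a → *𝟙-true ≡.refl) (column-off b)

    Bounded-rows : ∀ {g C} → (∀ a → Bounded (λ b → f (a , b)) (g a)) → Bounded g C → Bounded f C
    Bounded-rows rows = Fibres.fromFibres 0≤f proj₁ λ a → Row.Bounded-extension a (rows a)

    Bounded-columns : ∀ {g C} → (∀ b → Bounded (λ a → f (a , b)) (g b)) → Bounded g C → Bounded f C
    Bounded-columns columns = Fibres.fromFibres 0≤f proj₂ λ b → Column.Bounded-extension b (columns b)

    IsSum-rows : ∀ {g s} → (∀ a → IsSum (λ b → f (a , b)) (g a)) → IsSum g s → IsSum f s
    IsSum-rows rows = Fibres.IsSum-fromFibres 0≤f proj₁ λ a → Row.IsSum-extension a (rows a)

  -- The second factor may depend on the first coordinate, which serves independent coins as well as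
  -- the joint law of channel input and output.
  IsSum-product : ∀ {p : A → ℝ} {r : A → B → ℝ} → NonNegative p → (∀ a → NonNegative (r a)) →
    IsSum p 1# → (∀ a → IsSum (r a) 1#) → IsSum (λ x → p (proj₁ x) * r (proj₁ x) (proj₂ x)) 1#
  IsSum-product {p = p} 0≤p 0≤r sp sr = IsSum-rows (λ x → *-nonNeg (0≤p _) (0≤r _ _))
    (λ a → IsSum-cong (λ _ → refl) (*-identityʳ (p a)) (IsSum-* (0≤p a) (sr a))) sp

  IsSum-positive : ∀ {A : Set} {f : A → ℝ} {s} → 0# < s → IsSum f s → ∃ λ a → 0# < f a
  IsSum-positive {f = f} 0<s (_ , least) with em {P = ∃ λ a → 0# < f a}
  ... | yes h    = h
  ... | no  none = contradiction (least 0# λ G _ → ≤-respʳ (finiteSum-0 G) (finiteSum-mono G λ a _ →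
          [ id , (λ h → contradiction (a , h) none) ]′ (≤⊎> (f a) 0#))) (<⇒≱ 0<s)

  -- For families without fixed sign: t ≥ 0 takes care of the default value 0 of a divergent sum,
  -- and a convergent one may be treated through its partial sums.
  ∑-≤ : ∀ {A : Set} {f : A → ℝ} {t} → 0# ≤ t → (∀ s → HasSum f s → s ≤ t) → ∑ f ≤ t
  ∑-≤ {f = f} 0≤t h with em {P = ∃ (HasSum f)}
  ... | yes (s , hs) = h s hs
  ... | no  _        = 0≤t

  *-÷-≤ : ∀ {x y} → 0# ≤ x → 0# ≤ y → x * (y ÷ x) ≤ y
  *-÷-≤ {x} {y} 0≤x 0≤y with em {P = 0# ≈ x}
  ... | yes 0≈x = ≤-respˡ (trans (sym (zeroˡ _)) (*-congʳ 0≈x)) 0≤y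
  ... | no  0≉x = ≤-reflexive (trans (*-comm x _) (÷-* (0≤x , 0≉x)))

  -- Information of a channel with finitely many inputs

  module Channel {A B : Set} {p : A → ℝ} {q : A → B → ℝ}
    (0≤p : NonNegative p) (p-isSum : IsSum p 1#)
    (0≤q : ∀ a → NonNegative (q a)) (q-isSum : ∀ a → IsSum (q a) 1#)
    (inputs : List A) (∈-inputs : ∀ a → a ∈ inputs) where

    J : A × B → ℝ
    J x = p (proj₁ x) * q (proj₁ x) (proj₂ x)

    0≤J : NonNegative J
    0≤J x = *-nonNeg (0≤p _) (0≤q _ _)

    J-isSum : IsSum J 1#
    J-isSum = IsSum-product 0≤p 0≤q p-isSum q-isSum

    mˡ : A → ℝ
    mˡ = marginalˡ J

    mʳ : B → ℝ
    mʳ = marginalʳ J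

    row-isSum : ∀ a → IsSum (λ b → J (a , b)) (p a)
    row-isSum a = IsSum-cong (λ _ → refl) (*-identityʳ (p a)) (IsSum-* (0≤p a) (q-isSum a))

    mˡ≈p : ∀ a → mˡ a ≈ p a
    mˡ≈p a = ∑-unique (λ b → 0≤J (a , b)) (row-isSum a)

    column-isSum : ∀ b → IsSum (λ a → J (a , b)) (mʳ b)
    column-isSum b = ∑-isSum (λ a → 0≤J (a , b)) (Bounded-mono
      (λ a → ≤-respʳ (*-identityʳ (p a)) (*-monoˡ-≤ (0≤p a) (Bounded⇒≤ (proj₁ (q-isSum a)) b)))
        (proj₁ p-isSum))

    J≈mˡ*q : ∀ a b → J (a , b) ≈ mˡ a * q a b
    J≈mˡ*q a b = *-congʳ (sym (mˡ≈p a))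

    conditional≈q : ∀ a b → 0# < mˡ a → conditional J b a ≈ q a b
    conditional≈q a b 0<mˡ = antisym (÷-≤ 0<mˡ (≤-reflexive J≈)) (≤-÷ 0<mˡ (≤-reflexive (sym J≈)))
      where
      J≈ : J (a , b) ≈ q a b * mˡ a
      J≈ = trans (J≈mˡ*q a b) (*-comm _ _)

    positive-input : ∃ λ a → 0# < mˡ a
    positive-input = let a , 0<pa = IsSum-positive 0<1 p-isSum in a , <-respʳ (sym (mˡ≈p a)) 0<pa

    -- This is M of the overview, written with `conditional` so that it is literally the summand of
    -- `rényiMutualInformation`.
    peak : B → ℝ
    peak b = real (⨆ {I = Σ A λ a → 0# < mˡ a} λ i → [ conditional J b (proj₁ i) ])

    peak-isSup : ∀ b → _
    peak-isSup b = ⨆-real {I = Σ A λ a → 0# < mˡ a} (λ i → conditional J b (proj₁ i)) positive-input 1#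
      λ (a , 0<mˡ) → ≤-respˡ (sym (conditional≈q a b 0<mˡ)) (Bounded⇒≤ (proj₁ (q-isSum a)) b)

    q≤peak : ∀ a b → 0# < mˡ a → q a b ≤ peak b
    q≤peak a b 0<mˡ = ≤-respˡ (conditional≈q a b 0<mˡ) (proj₁ (peak-isSup b) (a , 0<mˡ))

    peak≤ : ∀ {b t} → (∀ a → q a b ≤ t) → peak b ≤ t
    peak≤ {b} {t} q≤t = proj₂ (peak-isSup b) t λ (a , 0<mˡ) → ≤-respˡ (sym (conditional≈q a b 0<mˡ)) (q≤t a)

    0≤peak : NonNegative peak
    0≤peak b = let a , 0<mˡ = positive-input in ≤-trans (0≤q a b) (q≤peak a b 0<mˡ)

    S : ℝ
    S = ∑ peak

    -- Finiteness of the input set makes the sum of the peaks converge.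
    S-isSum : IsSum peak S
    S-isSum = ∑-isSum 0≤peak (Bounded-mono (λ b → peak≤ λ a → ≤-finiteSum (λ a → 0≤q a b) (∈-inputs a))
      (proj₁ (IsSum-finiteSum 0≤q q-isSum inputs)))

    -- The peaks dominate the distribution `q a` of a single input a of positive probability. It
    -- yields log₂ S ≥ 0, on which the bound for the mutual information relies.
    1≤S : 1# ≤ S
    1≤S = let a , 0<mˡ = positive-input in IsSum-mono (λ b → q≤peak a b 0<mˡ) (q-isSum a) S-isSum

    0<S : 0# < S
    0<S = <-≤-trans 0<1 1≤S

    rényi≤ : ∀ d → Bounded peak (2# ^ d) → rényiMutualInformation J ≤ fromℕ d
    rényi≤ d peak≤2^d = ≤-respˡ (trans (*-congˡ (+-identityʳ 1#)) (*-identityʳ _))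
      (≤-respʳ (minus-0 (fromℕ d)) (log₂-upper d 0 0 0<S
        (≤-respˡ (sym (trans (*-identityˡ _) (*-identityʳ S)))
        (proj₂ S-isSum _ peak≤2^d))))
      where
      minus-0 : ∀ x → x - 0# ≈ x
      minus-0 = solve 1 (λ x → x :- con (+ 0) := x) refl

    -- The ratio M/m of the overview; it is 0 where the marginal vanishes.
    w : B → ℝ
    w b = peak b ÷ mʳ b

    weighted : A × B → ℝ
    weighted x = J x * w (proj₂ x)

    0≤mʳ : NonNegative mʳ
    0≤mʳ b = Bounded⇒nonNeg (proj₁ (column-isSum b))

    0≤w : NonNegative w
    0≤w b = *-nonNeg (0≤peak b) (⁻¹-nonNeg (0≤mʳ b))

    -- A column contributes mʳ b · w b. This equals `peak b` when mʳ b > 0 and is 0 otherwise, so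
    -- the columns together stay below S.
    weighted-bounded : Bounded weighted S
    weighted-bounded = Bounded-columns (λ x → *-nonNeg (0≤J x) (0≤w (proj₂ x)))
      (λ b → Bounded-weaken (≤-respˡ (*-comm (mʳ b) (w b)) (*-÷-≤ (0≤mʳ b) (0≤peak b)))
        (Bounded-mono (λ a → ≤-reflexive (*-comm _ _)) (proj₁ (IsSum-* (0≤w b) (column-isSum b)))))
      (proj₁ S-isSum)

    c : ℝ
    c = proj₁ log₂-below-tangent

    0≤c : 0# ≤ c
    0≤c = proj₁ (proj₂ log₂-below-tangent)

    information : A × B → ℝ
    information x = J x * log₂ (J x ÷ (mˡ (proj₁ x) * mʳ (proj₂ x)))

    -- The argument u of the logarithm equals q / mʳ and is thus at most w; the tangent at S is
    -- applied to u, and u is then enlarged to w, which c ≥ 0 permits. Where J vanishes, both sides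
    -- are 0 whatever the logarithm returns.
    information≤ : ∀ x → information x ≤ log₂ S * J x + c * (weighted x ÷ S - J x)
    information≤ x@(a , b) = [ positive , vanishing ]′ (cases (≤⊎> (J x) 0#))
      where
      cases : J x ≤ 0# ⊎ 0# < J x → 0# < J x ⊎ 0# ≈ J x
      cases (inj₁ J≤0) = inj₂ (antisym (0≤J x) J≤0)
      cases (inj₂ 0<J) = inj₁ 0<J
      0*-identity : ∀ l L c w i → 0# * l ≈ L * 0# + c * (0# * w * i - 0#)
      0*-identity = solve 5 (λ l L c w i → con (+ 0) :* l := L :* con (+ 0) :+ c :*
          (con (+ 0) :* w :* i :- con (+ 0))) refl
      vanishing : 0# ≈ J x → information x ≤ log₂ S * J x + c * (weighted x ÷ S - J x)
      vanishing 0≈J = ≤-reflexive (trans (*-congʳ (sym 0≈J)) (trans (0*-identity _ (log₂ S) c (w b) (S ⁻¹))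
        (+-cong (*-congˡ 0≈J) (*-congˡ (+-cong (*-congʳ (*-congʳ 0≈J)) (-‿cong 0≈J))))))
      positive : 0# < J x → information x ≤ log₂ S * J x + c * (weighted x ÷ S - J x)
      positive 0<J = ≤-trans (*-monoˡ-≤ (0≤J x) (proj₂ (proj₂ log₂-below-tangent) 0<u 0<S))
        (≤-respˡ (sym (expand (J x) (log₂ S) c u (S ⁻¹))) (+-monoʳ-≤ _ (*-monoˡ-≤ 0≤c (+-monoˡ-≤ _
          (*-monoʳ-≤ (⁻¹-nonNeg (<⇒≤ 0<S)) (*-monoˡ-≤ (0≤J x) u≤w))))))
        where
        u = J x ÷ (mˡ a * mʳ b)
        0<mˡ : 0# < mˡ a
        0<mˡ = <-≤-trans 0<J (≤-respʳ (sym (mˡ≈p a)) (Bounded⇒≤ (proj₁ (row-isSum a)) b))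
        0<mʳ : 0# < mʳ b
        0<mʳ = <-≤-trans 0<J (Bounded⇒≤ (proj₁ (column-isSum b)) a)
        0<u : 0# < u
        0<u = *-pos 0<J (⁻¹-pos (*-pos 0<mˡ 0<mʳ))
        rearrange : ∀ w l r → l * (w * r) ≈ w * (l * r)
        rearrange = solve 3 (λ w l r → l :* (w :* r) := w :* (l :* r)) refl
        u≤w : u ≤ w b
        u≤w = ÷-≤ (*-pos 0<mˡ 0<mʳ) (≤-respˡ (sym (J≈mˡ*q a b)) (≤-respʳ (rearrange (w b) (mˡ a) (mʳ b))
          (*-monoˡ-≤ (<⇒≤ 0<mˡ) (≤-respʳ (sym (÷-* 0<mʳ)) (q≤peak a b 0<mˡ)))))
        expand : ∀ j L c u i → j * (L + c * (u * i - 1#)) ≈ L * j + c * (j * u * i - j)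
        expand = solve 5 (λ j L c u i → j :* (L :+ c :* (u :* i :- con (+ 1))) := L :* j :+ c :*
            (j :* u :* i :- j)) refl

    -- The sum is kept finite because the terms of `information` have no fixed sign; linearity
    -- leaves on the right only partial sums of the non-negative families J and `weighted`.
    finiteInformation≤ : ∀ G → finiteSum information G ≤
      log₂ S * finiteSum J G + c * (finiteSum weighted G ÷ S - finiteSum J G)
    finiteInformation≤ G = ≤-trans (finiteSum-mono G λ x _ → information≤ x) (≤-reflexive (linear G))
      where
      step : ∀ L c i j h j′ h′ → L * j + c * (h * i - j) + (L * j′ + c * (h′ * i - j′)) ≈
                                 L * (j + j′) + c * ((h + h′) * i - (j + j′))
      step = solve 7 (λ L c i j h j′ h′ → L :* j :+ c :* (h :* i :- j) :+
          (L :* j′ :+ c :* (h′ :* i :- j′)) :=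
                                 L :* (j :+ j′) :+ c :* ((h :+ h′) :* i :- (j :+ j′))) refl
      nil : ∀ L c i → 0# ≈ L * 0# + c * (0# * i - 0#)
      nil = solve 3 (λ L c i → con (+ 0) := L :* con (+ 0) :+ c :* (con (+ 0) :* i :- con (+ 0))) refl
      linear : ∀ G → finiteSum (λ x → log₂ S * J x + c * (weighted x ÷ S - J x)) G ≈
        log₂ S * finiteSum J G + c * (finiteSum weighted G ÷ S - finiteSum J G)
      linear []      = nil (log₂ S) c (S ⁻¹)
      linear (x ∷ G) = trans (+-congˡ (linear G))
        (step (log₂ S) c (S ⁻¹) (J x) (weighted x) (finiteSum J G) (finiteSum weighted G))

    -- The list G is large enough for two approximations at once: the information is within ε of its
    -- sum, and J sums to at least 1 - ε. The first costs ε and the second, multiplied by the slope,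
    -- costs c ε, whence the factor 1 + c.
    mutualInformation≤rényi : mutualInformation J ≤ rényiMutualInformation J
    mutualInformation≤rényi = ∑-≤ (log₂-nonNeg 1≤S) λ s hs → ≤-byε (+-nonNeg 0≤1 0≤c) λ ε 0<ε →
      let F , close  = hs ε 0<ε
          F′ , close′ = IsSum⇒HasSum 0≤J J-isSum ε 0<ε
          G = nub (F ++ F′)
          uG = nub-unique (F ++ F′)
      in conclude s ε (log₂ S) c (finiteSum information G) (finiteSum J G) (finiteSum weighted G ÷ S)
           (log₂-nonNeg 1≤S) 0≤c
           (proj₁ (close G uG ∈-nub-++ˡ)) (finiteInformation≤ G)
           (proj₁ J-isSum G uG) (proj₁ (close′ G uG (∈-nub-++ʳ F)))
           (÷-≤ 0<S (≤-respʳ (sym (*-identityˡ S)) (weighted-bounded G uG)))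
      where
      identity : ∀ s ε L c f j h → L + (1# + c) * ε ≈ s + ((f - (s - ε)) + ((L * j + c * (h - j)) - f) +
        (L * (1# - j) + (c * (j - (1# - ε)) + c * (1# - h))))
      identity = solve 7 (λ s ε L c f j h → L :+ (con (+ 1) :+ c) :* ε := s :+
          ((f :- (s :- ε)) :+ ((L :* j :+ c :* (h :- j)) :- f) :+
        (L :* (con (+ 1) :- j) :+ (c :* (j :- (con (+ 1) :- ε)) :+ c :* (con (+ 1) :- h))))) refl
      conclude : ∀ s ε L c f j h → 0# ≤ L → 0# ≤ c → s - ε ≤ f → f ≤ L * j + c * (h - j) →
        j ≤ 1# → 1# - ε ≤ j → h ≤ 1# → s ≤ L + (1# + c) * ε
      conclude s ε L c f j h 0≤L 0≤c s-ε≤f f≤ j≤1 1-ε≤j h≤1 = ≤-byDifference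
        (+-nonNeg (+-nonNeg (x≤y⇒0≤y-x s-ε≤f) (x≤y⇒0≤y-x f≤))
          (+-nonNeg (*-nonNeg 0≤L (x≤y⇒0≤y-x j≤1))
            (+-nonNeg (*-nonNeg 0≤c (x≤y⇒0≤y-x 1-ε≤j)) (*-nonNeg 0≤c (x≤y⇒0≤y-x h≤1)))))
        (identity s ε L c f j h)

  -- Protocols

  ≤±-trans : ∀ {x y z} → x ≤± y → y ≤± z → x ≤± z
  ≤±-trans = Extended.≤±-trans _≤_ ≤-trans

  ⨆-upper : ∀ {ℓ} {I : Set ℓ} (F : I → ℝ±) i → F i ≤± ⨆ F
  ⨆-upper F = proj₁ (proj₂ (lub F))

  ⨆-least : ∀ {ℓ} {I : Set ℓ} (F : I → ℝ±) {t} → (∀ i → F i ≤± t) → ⨆ F ≤± t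
  ⨆-least F = proj₂ (proj₂ (lub F)) _

  ⨆-mono : ∀ {ℓ} {I : Set ℓ} (F G : I → ℝ±) → (∀ i → F i ≤± G i) → ⨆ F ≤± ⨆ G
  ⨆-mono F G F≤G = ⨆-least F λ i → ≤±-trans (F≤G i) (⨆-upper G i)

  ⨅-mono : ∀ {ℓ} {I : Set ℓ} (F G : I → ℝ±) → (∀ i → F i ≤± G i) → ⨅ F ≤± ⨅ G
  ⨅-mono F G F≤G = ⨆-least proj₁ λ (t , t≤F) → ⨆-upper proj₁ (t , λ i → ≤±-trans (t≤F i) (F≤G i))

  fromℕ-cancel-≤ : ∀ {m n} → fromℕ m ≤ fromℕ n → m ℕ.≤ n
  fromℕ-cancel-≤ {m} {n} h with m ℕ.≤? n
  ... | yes m≤n = m≤n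
  ... | no  m≰n = contradiction (≤-trans (fromℕ-mono-≤ (ℕ.≰⇒> m≰n)) h) λ n+1≤n →
        <⇒≱ 0<1 (+-cancelʳ-≤ (fromℕ n) (≤-respʳ (sym (+-identityˡ (fromℕ n))) n+1≤n))

  -- Rounding r up would weaken the final inequality. The search descends to the largest value that
  -- l attains, and an attained value is at most r.
  natural-bound : ∀ {I : Set} (l : I → ℕ) → I → ∀ {r} → (∀ i → fromℕ (l i) ≤ r) →
                  ∃ λ d → (∀ i → l i ℕ.≤ d) × fromℕ d ≤ r
  natural-bound {I} l i₀ {r} l≤r = let N , r≤N = archimedean r in
    search N λ i → fromℕ-cancel-≤ (≤-trans (l≤r i) r≤N)
    where
    search : ∀ N → (∀ i → l i ℕ.≤ N) → ∃ λ d → (∀ i → l i ℕ.≤ d) × fromℕ d ≤ r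
    search zero    l≤0 = 0 , l≤0 , ≤-trans (fromℕ-nonNeg (l i₀)) (l≤r i₀)
    search (suc N) l≤N+1 with em {P = ∃ λ i → l i ≡ suc N}
    ... | yes (i , li≡) = suc N , l≤N+1 , ≡.subst (λ n → fromℕ n ≤ r) li≡ (l≤r i)
    ... | no  none      = search N λ i → ℕ.≤-pred (ℕ.≤∧≢⇒< (l≤N+1 i) λ eq → none (i , eq))

  -- Leaves of protocol trees

  module _ {U V : Set} where

    -- Leaves are named by their transcripts, and paths longer than d are dropped: the tree may
    -- continue below depth d along branches taken with probability zero.
    leaves : ℕ → Tree U V → List (List Bool)
    leaves d       leaf          = [] ∷ []
    leaves zero    (alice _ _ _) = []
    leaves zero    (bob _ _ _)   = []
    leaves (suc d) (alice _ l r) = map (false List.∷_) (leaves d l) ++ map (true List.∷_) (leaves d r)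
    leaves (suc d) (bob _ l r)   = map (false List.∷_) (leaves d l) ++ map (true List.∷_) (leaves d r)

    branch-length : ∀ d (ls rs : List (List Bool)) →
      fromℕ (length ls) ≤ 2# ^ d → fromℕ (length rs) ≤ 2# ^ d →
      fromℕ (length (map (false List.∷_) ls ++ map (true List.∷_) rs)) ≤ 2# ^ suc d
    branch-length d ls rs ls≤ rs≤
      rewrite length-++ (map (false List.∷_) ls) {map (true List.∷_) rs} | length-map
          (false List.∷_) ls | length-map (true List.∷_) rs =
      ≤-respʳ (sym (2*≈+ (2# ^ d))) (≤-respˡ (sym (fromℕ-homo-+ (length ls) (length rs)))
          (+-mono-≤ ls≤ rs≤))

    leaves-length : ∀ d t → fromℕ (length (leaves d t)) ≤ 2# ^ d
    leaves-length d       leaf          = ≤-respˡ (sym (+-identityʳ 1#)) (1≤2^ d)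
    leaves-length zero    (alice _ _ _) = 0≤1
    leaves-length zero    (bob _ _ _)   = 0≤1
    leaves-length (suc d) (alice _ l r) = branch-length d (leaves d l) (leaves d r) (leaves-length d l)
        (leaves-length d r)
    leaves-length (suc d) (bob _ l r)   = branch-length d (leaves d l) (leaves d r) (leaves-length d l)
        (leaves-length d r)

    transcript-∈-leaves : ∀ d t (u : U) (v : V) → length (transcript t u v) ℕ.≤ d →
        transcript t u v ∈ leaves d t
    transcript-∈-leaves d       leaf u v _ = here ≡.refl
    transcript-∈-leaves zero    (alice bit l r) u v h with bit u | h
    ... | false | ()
    ... | true  | ()
    transcript-∈-leaves (suc d) (alice bit l r) u v h with bit u | h
    ... | false | ℕ.s≤s h′ = ∈-++⁺ˡ (∈-map⁺ (false List.∷_) (transcript-∈-leaves d l u v h′))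
    ... | true  | ℕ.s≤s h′ = ∈-++⁺ʳ (map (false List.∷_) (leaves d l))
        (∈-map⁺ (true List.∷_) (transcript-∈-leaves d r u v h′))
    transcript-∈-leaves zero    (bob bit l r) u v h with bit v | h
    ... | false | ()
    ... | true  | ()
    transcript-∈-leaves (suc d) (bob bit l r) u v h with bit v | h
    ... | false | ℕ.s≤s h′ = ∈-++⁺ˡ (∈-map⁺ (false List.∷_) (transcript-∈-leaves d l u v h′))
    ... | true  | ℕ.s≤s h′ = ∈-++⁺ʳ (map (false List.∷_) (leaves d l))
        (∈-map⁺ (true List.∷_) (transcript-∈-leaves d r u v h′))

  -- Each member of K lying in L is charged to an equal entry of L; since K has no repetitions,
  -- every entry is charged at most once.
  Bounded-indicator : ∀ {A : Set} (L : List A) → Bounded (λ a → 𝟙 (a ∈ L)) (fromℕ (length L))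
  Bounded-indicator L K uK = begin
    finiteSum (λ a → 𝟙 (a ∈ L)) K                             ≤⟨ finiteSum-mono K (λ a _ → pointwise a) ⟩
    finiteSum (λ a → finiteSum (λ l → 1# * 𝟙 (l ≡ a)) L) K    ≈⟨ finiteSum-swap
        (λ a l → 1# * 𝟙 (l ≡ a)) K L ⟩
    finiteSum (λ l → finiteSum (λ a → 1# * 𝟙 (l ≡ a)) K) L    ≤⟨ finiteSum-mono L
        (λ l _ → finiteSum-indicator-≤ 0≤1 l uK) ⟩
    finiteSum (λ _ → 1#) L                                    ≈⟨ finiteSum-const 1# L ⟩
    fromℕ (length L) * 1#                                     ≈⟨ *-identityʳ _ ⟩
    fromℕ (length L)                                          ∎
    where
    open ≤-Reasoning
    0≤ : ∀ a l → 0# ≤ 1# * 𝟙 (l ≡ a)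
    0≤ a l = *𝟙-nonNeg (l ≡ a) 0≤1
    pointwise : ∀ a → 𝟙 (a ∈ L) ≤ finiteSum (λ l → 1# * 𝟙 (l ≡ a)) L
    pointwise a = [ (λ a∈L → ≤-respˡ (trans (*𝟙-true ≡.refl) (sym (𝟙-true a∈L))) (≤-finiteSum (0≤ a) a∈L)) ,
                    (λ a∉L → ≤-respˡ (sym (𝟙-false a∉L)) (finiteSum-nonNeg (0≤ a) L)) ]′ (decide (a ∈ L))

  -- The channel from the inputs to coins and transcript

  module ProtocolInformation {X Y Z : Set} (π : Protocol X Y Z)
    (inputs : List (X × Y)) (∈-inputs : ∀ x → x ∈ inputs) where
    open Protocol π

    Dist-isSum : ∀ {A : Set} (p : Dist A) → IsSum (pmf p) 1#
    Dist-isSum p = HasSum⇒IsSum (nonNeg p) (sumsTo1 p)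

    P : Outcome π → ℝ
    P = probability π

    private-nonNeg : NonNegative (λ (ab : CoinsA × CoinsB) → pmf private-coinsA
        (proj₁ ab) * pmf private-coinsB (proj₂ ab))
    private-nonNeg (a , b) = *-nonNeg (nonNeg private-coinsA a) (nonNeg private-coinsB b)

    private-isSum : IsSum (λ (ab : CoinsA × CoinsB) → pmf private-coinsA (proj₁ ab) * pmf private-coinsB
        (proj₂ ab)) 1#
    private-isSum = IsSum-product (nonNeg private-coinsA) (λ _ → nonNeg private-coinsB)
      (Dist-isSum private-coinsA) (λ _ → Dist-isSum private-coinsB)

    0≤P : NonNegative P
    0≤P (φ , ab) = *-nonNeg (nonNeg public-coins φ) (private-nonNeg ab)

    P-isSum : IsSum P 1#
    P-isSum = IsSum-product (nonNeg public-coins) (λ _ → private-nonNeg) (Dist-isSum public-coins)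
        (λ _ → private-isSum)

    q : X × Y → Coins × List Bool → ℝ
    q (x , y) τ = Pr π λ ω → Π π x y ω ≡ τ

    module Outcomes (x : X) (y : Y) = Fibres 0≤P (Π π x y)

    q-fibre : ∀ x y τ → IsSum (Outcomes.fibre x y τ) (q (x , y) τ)
    q-fibre x y τ = ∑-isSum (Outcomes.fibre-nonNeg x y τ)
        (Bounded-mono (λ ω → *𝟙-≤ _ (0≤P ω)) (proj₁ P-isSum))

    0≤q : ∀ xy → NonNegative (q xy)
    0≤q (x , y) τ = Bounded⇒nonNeg (proj₁ (q-fibre x y τ))

    -- For fixed inputs, the values of `Π` partition the outcomes, and q lists the probabilities of
    -- the parts.
    q-isSum : ∀ xy → IsSum (q xy) 1#
    q-isSum (x , y) = Outcomes.IsSum-toFibres x y (q-fibre x y) P-isSum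

    module Input (p : Dist (X × Y)) = Channel {q = q} (nonNeg p) (Dist-isSum p) 0≤q q-isSum inputs ∈-inputs

    module _ (d : ℕ) (length≤d : ∀ x y ω → 0# < P ω → length (Ψ π x y ω) ℕ.≤ d) where

      cover : Coins × List Bool → ℝ
      cover (φ , τ) = pmf public-coins φ * 𝟙 (τ ∈ leaves d (tree φ))

      0≤cover : NonNegative cover
      0≤cover (φ , τ) = *𝟙-nonNeg _ (nonNeg public-coins φ)

      φ-isSum : ∀ φ → IsSum (λ ω → P ω * 𝟙 (proj₁ ω ≡ φ)) (pmf public-coins φ)
      φ-isSum φ = Row.IsSum-extension 0≤P φ
          (IsSum-cong (λ _ → refl) (*-identityʳ _) (IsSum-* (nonNeg public-coins φ) private-isSum))

      -- If τ is among the leaves, the event lies inside the event that the public coins are φ. If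
      -- it is not, every outcome producing τ has probability zero, since `length≤d` puts the
      -- transcripts of all other outcomes among the leaves.
      q≤cover : ∀ xy τ → q xy τ ≤ cover τ
      q≤cover (x , y) (φ , τ) = proj₂ (q-fibre x y (φ , τ)) _
          ([ reached , unreached ]′ (decide (τ ∈ leaves d (tree φ))))
        where
        fibre = Outcomes.fibre x y (φ , τ)
        reached : τ ∈ leaves d (tree φ) → Bounded fibre (cover (φ , τ))
        reached τ∈ = Bounded-weaken (≤-reflexive (sym (*𝟙-true τ∈)))
            (Bounded-mono pointwise (proj₁ (φ-isSum φ)))
          where
          pointwise : ∀ ω → fibre ω ≤ P ω * 𝟙 (proj₁ ω ≡ φ)
          pointwise ω = [ (λ eq → ≤-trans (*𝟙-≤ _ (0≤P ω))
              (≤-reflexive (sym (*𝟙-true (≡.cong proj₁ eq))))) ,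
                          (λ neq → ≤-respˡ (sym (*𝟙-false neq)) (*𝟙-nonNeg _ (0≤P ω))) ]′
                            (decide (Π π x y ω ≡ (φ , τ)))
        unreached : τ ∉ leaves d (tree φ) → Bounded fibre (cover (φ , τ))
        unreached τ∉ = Bounded-weaken (0≤cover (φ , τ)) (Bounded-mono pointwise (proj₁ IsSum-0))
          where
          pointwise : ∀ ω → fibre ω ≤ 0#
          pointwise ω = [ possible , (λ neq → ≤-reflexive (*𝟙-false neq)) ]′ (decide (Π π x y ω ≡ (φ , τ)))
            where
            possible : Π π x y ω ≡ (φ , τ) → fibre ω ≤ 0#
            possible ≡.refl = [ (λ P≤0 → ≤-trans (*𝟙-≤ _ (0≤P ω)) P≤0) ,
              (λ 0<P → contradiction (transcript-∈-leaves d (tree φ) _ _ (length≤d x y ω 0<P)) τ∉) ]′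
                (≤⊎> (P ω) 0#)

      cover-bounded : Bounded cover (2# ^ d)
      cover-bounded = Bounded-rows 0≤cover
        (λ φ → Bounded-weaken (≤-respˡ (*-comm _ _)
          (*-monoʳ-≤ (nonNeg public-coins φ) (leaves-length d (tree φ))))
          (scaled (nonNeg public-coins φ) (Bounded-indicator (leaves d (tree φ)))))
        (Bounded-weaken (≤-reflexive (*-identityʳ _))
          (proj₁ (IsSum-* (<⇒≤ (0<2^ d)) (Dist-isSum public-coins))))
        where
        scaled : ∀ {A : Set} {f : A → ℝ} {c C} → 0# ≤ c → Bounded f C → Bounded (λ a → c * f a) (c * C)
        scaled {f = f} {c} 0≤c f≤C G uG = ≤-respˡ (sym (finiteSum-* c f G)) (*-monoˡ-≤ 0≤c (f≤C G uG))

      rényi≤length : ∀ p → rényiMutualInformation (joint π p) ≤ fromℕ d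
      rényi≤length p = Input.rényi≤ p d
          (Bounded-mono (λ τ → Input.peak≤ p λ xy → q≤cover xy τ) cover-bounded)

    rényi≤#bits : X × Y → ∀ p →
      [ rényiMutualInformation (joint π p) ] ≤± ⨆ {I = X × Y} λ (x , y) → #bits π x y
    rényi≤#bits xy₀ p = bound _ λ x y ω → ≤±-trans (⨆-upper _ ω)
        (⨆-upper (λ (xy : X × Y) → #bits π (proj₁ xy) (proj₂ xy)) (x , y))
      where
      ω₀ : Σ (Outcome π) λ ω → 0# < P ω
      ω₀ = IsSum-positive 0<1 P-isSum
      Run : Set
      Run = (X × Y) × Σ (Outcome π) λ ω → 0# < P ω
      -- The supremum is generalised to an arbitrary upper bound D of all lengths, so that its three
      -- forms can be distinguished. The existence of a run rules out ⊥±, and a real D is exchanged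
      -- for a natural depth.
      bound : ∀ D →
        (∀ x y (ω : Σ (Outcome π) λ ω → 0# < P ω) → [ fromℕ (length (Ψ π x y (proj₁ ω))) ] ≤± D) →
        [ rényiMutualInformation (joint π p) ] ≤± D
      bound ⊤±    h = _ ≤⊤±
      bound ⊥±    h = contradiction (h (proj₁ xy₀) (proj₂ xy₀) ω₀) [ _ ]≰⊥±
      bound [ r ] h =
        let d , length≤d , d≤r = natural-bound {Run} (λ ((x , y) , ω , _) → length (Ψ π x y ω)) (xy₀ , ω₀)
                                   λ ((x , y) , ω) → [≤]-injective (h x y ω)
        in Extended.[ ≤-trans (rényi≤length d (λ x y ω 0<P → length≤d ((x , y) , ω , 0<P)) p) d≤r ]

  -- Enumeration of the inputs and passage to the infima

  elements : ∀ {A : Set} {n} → A ↔ Fin n → List A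
  elements A↔Fin = map (Inverse.from A↔Fin) (allFin _)

  ∈-elements : ∀ {A : Set} {n} (A↔Fin : A ↔ Fin n) a → a ∈ elements A↔Fin
  ∈-elements A↔Fin a = ≡.subst (_∈ elements A↔Fin) (Inverse.strictlyInverseʳ A↔Fin a)
    (∈-map⁺ (Inverse.from A↔Fin) (∈-allFin (Inverse.to A↔Fin a)))

  informationComplexity-≤ : ∀ {X Y Z : Set} {m n : ℕ} → X ↔ Fin (suc m) → Y ↔ Fin (suc n) →
    (f : X → Y → Pred Z 0ℓ) (ℰ : X → Y → ℝ) → (IC f ℰ ≤± IC∞ f ℰ) × (IC∞ f ℰ ≤± R f ℰ)
  informationComplexity-≤ {X} {Y} X↔ Y↔ f ℰ =
    ⨅-mono _ _ (λ (π , _) → ⨆-mono _ _ λ p → Extended.[ Info.Input.mutualInformation≤rényi π p ]) ,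
    -- Both comparisons are made for each protocol separately. Here the bound is the same for every
    -- p, and the pair of first elements witnesses that there is an input at all.
    ⨅-mono _ _ (λ (π , _) → ⨆-least _ (Info.rényi≤#bits π (Inverse.from X↔ fzero , Inverse.from Y↔ fzero)))
    where
    module Info π = ProtocolInformation {X} {Y} π (cartesianProduct (elements X↔) (elements Y↔))
      (λ (x , y) → ∈-cartesianProduct⁺ (∈-elements X↔ x) (∈-elements Y↔ y))

theorem1 : (em : ∀ {ℓ : Level} → ExcludedMiddle ℓ) (real-field : CompleteOrderedField) →
    let open Communication em real-field in
    ∀ {X Y Z : Set} {m n k : ℕ} →
    X ↔ Fin (suc m) → Y ↔ Fin (suc n) → Z ↔ Fin (suc k) →
    (f : X → Y → Pred Z 0ℓ) (ℰ : X → Y → ℝ) →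
    (∀ x y → 0# ≤ ℰ x y × ℰ x y ≤ 1#) →
    (IC f ℰ ≤± IC∞ f ℰ) × (IC∞ f ℰ ≤± R f ℰ)
theorem1 em real-field X↔Fin Y↔Fin _ f ℰ _ = Proof.informationComplexity-≤ em real-field X↔Fin Y↔Fin f ℰ
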